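{- For each odd integer $d\ge 5$, there are only finitely many graphs of degree $d$ with cyclic defect (of any diameter) or with cyclic excess (of any odd girth). Moreover, the number of such graphs of degree $d$ is bounded asymptotically by $O\!\left(\tfrac{64}{3}d^{3/2}\right)$.
   Context: For an integer $d\ge 1$ define polynomials $G_{d,m}(x)$ by $G_{d,0}(x)=1$, $G_{d,1}(x)=x+1$, and $G_{d,m+1}(x)=xG_{d,m}(x)-(d-1)G_{d,m-1}(x)$ for $m\ge1$. Let $J_n$ be the $n\times n$ all-ones matrix. For a graph on $n\ge3$ vertices, a cycle matrix is the adjacency matrix $B$ of an $n$-cycle on the same vertex set (i.e., for some ordering $v_1,\dots,v_n$ of the vertices, $B_{ij}=1$ iff $v_i,v_j$ are cyclically consecutive, and $0$ otherwise); this cycle need not consist of edges of the graph. A graph $\Gamma$ of order $n$ with adjacency matrix $A$ is a graph of degree $d$, diameter $D$ and cyclic defect if $\Gamma$ is $d$-regular with $d\ge3$, has diameter $D\ge2$, and $G_{d,D}(A)=J_n+B$ for some cycle matrix $B$. It is a graph of degree $d$, girth $g$ and cyclic excess if $\Gamma$ is $d$-regular with $d\ge3$, has odd girth $g\ge5$, and $G_{d,\lfloor g/2\rfloor}(A)=J_n-B$ for some cycle matrix $B$. -}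

module Defs where

open import Data.Bool using (Bool; true; false; if_then_else_)
open import Data.Nat as ℕ using (ℕ; zero; suc; _≤_; _<_; _∸_; _%_; ⌊_/2⌋)
open import Data.Integer as ℤ using (ℤ; +_)
open import Data.Fin using (Fin; toℕ)
open import Data.List using (List; []; _∷_; length; map; allFin)
open import Data.Nat.ListAction using (sum)
open import Data.List.Relation.Unary.Any using (Any)
open import Data.Product using (Σ; ∃; _×_; _,_; proj₂)
open import Data.Sum using (_⊎_)
open import Function.Bundles using (_↔_; Inverse)
open import Function.Definitions using (Injective)
open import Relation.Nullary using (¬_)
open import Relation.Binary.PropositionalEquality using (_≡_)

record Graph (n : ℕ) : Set where
  field
    adj     : Fin n → Fin n → Bool
    adj-sym : ∀ i j → adj i j ≡ adj j i
    irrefl  : ∀ i → adj i i ≡ false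
open Graph public

degree : ∀ {n} → Graph n → Fin n → ℕ
degree {n} G i = sum (map (λ j → if adj G i j then 1 else 0) (allFin n))

Regular : ∀ {n} → Graph n → ℕ → Set
Regular G d = ∀ i → degree G i ≡ d

data Walk {n : ℕ} (G : Graph n) : ℕ → Fin n → Fin n → Set where
  nil  : ∀ {u} → Walk G 0 u u
  cons : ∀ {k u w v} → adj G u w ≡ true → Walk G k w v → Walk G (suc k) u v

DistLe : ∀ {n} → Graph n → ℕ → Fin n → Fin n → Set
DistLe G k u v = ∃ λ j → j ≤ k × Walk G j u v

Diameter : ∀ {n} → Graph n → ℕ → Set
Diameter G D = (∀ u v → DistLe G D u v)
             × (∃ λ u → ∃ λ v → ∀ k → k < D → ¬ DistLe G k u v)

Next : ∀ {k} → Fin k → Fin k → Set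
Next {k} i j = (toℕ j ≡ suc (toℕ i)) ⊎ ((suc (toℕ i) ≡ k) × (toℕ j ≡ 0))

Consec : ∀ {k} → Fin k → Fin k → Set
Consec i j = Next i j ⊎ Next j i

Cycle : ∀ {n} → Graph n → ℕ → Set
Cycle {n} G k = 3 ≤ k × (Σ (Fin k → Fin n) λ f →
                  Injective _≡_ _≡_ f × (∀ i j → Next i j → adj G (f i) (f j) ≡ true))

Girth : ∀ {n} → Graph n → ℕ → Set
Girth G g = Cycle G g × (∀ k → k < g → ¬ Cycle G k)

Matrix : ℕ → Set
Matrix n = Fin n → Fin n → ℤ

sumFin : ∀ n → (Fin n → ℤ) → ℤ
sumFin zero    f = + 0
sumFin (suc n) f = f Fin.zero ℤ.+ sumFin n (λ i → f (Fin.suc i))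
  where import Data.Fin as Fin

idM : ∀ {n} → Matrix n
idM i j = if ⌊ i Data.Fin.≟ j ⌋ then + 1 else + 0
  where open import Relation.Nullary.Decidable using (⌊_⌋)

_⊕_ : ∀ {n} → Matrix n → Matrix n → Matrix n
(A ⊕ B) i j = A i j ℤ.+ B i j

_⊗_ : ∀ {n} → Matrix n → Matrix n → Matrix n
_⊗_ {n} A B i j = sumFin n (λ k → A i k ℤ.* B k j)

_·M_ : ∀ {n} → ℤ → Matrix n → Matrix n
(c ·M A) i j = c ℤ.* A i j

J : ∀ {n} → Matrix n
J i j = + 1

adjMatrix : ∀ {n} → Graph n → Matrix n
adjMatrix G i j = if adj G i j then + 1 else + 0

IsCycleMatrix : ∀ {n} → Matrix n → Set
IsCycleMatrix {n} B = 3 ≤ n × (Σ (Fin n ↔ Fin n) λ σ →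
  ∀ i j → let open Inverse σ in
    (Consec i j → B (to i) (to j) ≡ + 1) × (¬ Consec i j → B (to i) (to j) ≡ + 0))

-- Polynomials over ℤ (coefficient lists, constant term first)

Poly : Set
Poly = List ℤ

_+P_ : Poly → Poly → Poly
[] +P q = q
(a ∷ p) +P [] = a ∷ p
(a ∷ p) +P (b ∷ q) = (a ℤ.+ b) ∷ (p +P q)

_·P_ : ℤ → Poly → Poly
c ·P p = map (c ℤ.*_) p

xP : Poly → Poly
xP p = + 0 ∷ p

Gpoly : ℕ → ℕ → Poly
Gpoly d zero = + 1 ∷ []
Gpoly d (suc zero) = + 1 ∷ + 1 ∷ []
Gpoly d (suc (suc m)) = xP (Gpoly d (suc m)) +P ((ℤ.- (+ (d ∸ 1))) ·P Gpoly d m)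

evalM : ∀ {n} → Poly → Matrix n → Matrix n
evalM [] A = λ _ _ → + 0
evalM (c ∷ p) A = (c ·M idM) ⊕ (A ⊗ evalM p A)

CyclicDefect : ∀ {n} → ℕ → ℕ → Graph n → Set
CyclicDefect {n} d D G =
  3 ≤ d × Regular G d × 2 ≤ D × Diameter G D ×
  (Σ (Matrix n) λ B → IsCycleMatrix B ×
     (∀ i j → evalM (Gpoly d D) (adjMatrix G) i j ≡ J i j ℤ.+ B i j))

CyclicExcess : ∀ {n} → ℕ → ℕ → Graph n → Set
CyclicExcess {n} d g G =
  3 ≤ d × Regular G d × g % 2 ≡ 1 × 5 ≤ g × Girth G g ×
  (Σ (Matrix n) λ B → IsCycleMatrix B ×
     (∀ i j → evalM (Gpoly d ⌊ g /2⌋) (adjMatrix G) i j ≡ J i j ℤ.- B i j))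

Cyclic : ∀ {n} → ℕ → Graph n → Set
Cyclic d G = (∃ λ D → CyclicDefect d D G) ⊎ (∃ λ g → CyclicExcess d g G)

Iso : ∀ {n m} → Graph n → Graph m → Set
Iso {n} {m} G H = Σ (Fin n ↔ Fin m) λ f →
  ∀ i j → adj H (Inverse.to f i) (Inverse.to f j) ≡ adj G i j

Covers : ℕ → List (Σ ℕ Graph) → Set
Covers d L = ∀ n (G : Graph n) → Cyclic d G → Any (λ p → Iso G (proj₂ p)) L

module Submission where

-- In fact no such graph of degree d ≥ 5 exists. If G(A) = J ± B, then A commutes with the cycle
-- matrix B, which says that the entries of A, indexed along the cycle, satisfy the discrete wave
-- equation. Since A vanishes on the diagonal, it is constant on every diagonal at even distance.
-- If some even diagonal consists of edges, the graph contains many 4-cycles through one edge u s: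
-- this contradicts girth ≥ 5 and, by counting non-backtracking walks, the fact that G(A) has only
-- two entries 2 in row u. Otherwise the graph is bipartite with respect to the parity along the
-- cycle, and the alternating vector gives (1 − d)^m = ∓ 2, which is impossible.

open import Defs
open import Data.Bool using (true; false; if_then_else_)
open import Data.Empty using (⊥)
open import Data.Fin using (Fin; zero; suc)
import Data.Fin as Fin
import Data.Fin.Properties as Fin
open import Data.Integer as ℤ using (ℤ; +_; -_; +≤+)
import Data.Integer.Properties as ℤₚ
open import Data.Integer.Tactic.RingSolver using (solve-∀)
open import Data.List using (List; []; length; tabulate)
open import Data.List.Properties using (map-tabulate)
open import Data.Nat using (ℕ; _≤_; _*_; _%_; _/_; ⌊_/2⌋)
import Data.Nat as ℕ
open import Data.Nat.Divisibility using (_∣_; divides; ∣⇒≤)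
open import Data.Nat.DivMod
  using (_mod_; m≡m%n+[m/n]*n; m%n<n; m<n⇒m%n≡m; n%n≡0; [m+kn]%n≡m%n; %-distribˡ-+)
open import Data.Nat.ListAction using (sum)
import Data.Nat.Properties as ℕ
import Data.Nat.Tactic.RingSolver as ℕ-solver
open import Data.Product using (Σ; ∃; _×_; _,_; proj₁; proj₂)
open import Data.Sum using (_⊎_; inj₁; inj₂; [_,_]′; swap)
open import Data.Vec using (Vec; []; _∷_; lookup)
open import Data.Vec.Relation.Unary.All using ([]; _∷_)
open import Data.Vec.Relation.Unary.AllPairs using ([]; _∷_)
open import Data.Vec.Relation.Unary.Unique.Propositional using (Unique)
open import Data.Vec.Relation.Unary.Unique.Propositional.Properties using (lookup-injective)
open import Function using (_∘_)
open import Function.Bundles using (_↔_; Inverse; Injection)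
open import Function.Properties.Inverse using (↔⇒↣)
open import Relation.Binary.PropositionalEquality
  using (_≡_; refl; sym; trans; cong; cong₂; subst; module ≡-Reasoning)
open import Relation.Nullary using (¬_; yes; no; contradiction)

open import Algebra.Properties.AbelianGroup ℤₚ.+-0-abelianGroup
  using () renaming (∙-cancelʳ to +-cancelʳ; ∙-cancelˡ to +-cancelˡ)
open import Algebra.Properties.CommutativeMonoid.Sum ℤₚ.+-0-commutativeMonoid
  using (∑-distrib-+; ∑-comm) renaming (sum to ∑)
open import Algebra.Properties.Semiring.Sum ℤₚ.+-*-semiring using (*-distribˡ-sum)

-- Finite sums of integers.

-- Carries the library's results on `∑` over to `sumFin`.
sumFin≡∑ : ∀ n (f : Fin n → ℤ) → sumFin n f ≡ ∑ f
sumFin≡∑ ℕ.zero    f = refl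
sumFin≡∑ (ℕ.suc n) f = cong (ℤ._+_ (f zero)) (sumFin≡∑ n (f ∘ suc))

sumFin-cong : ∀ {n} {f g : Fin n → ℤ} → (∀ i → f i ≡ g i) → sumFin n f ≡ sumFin n g
sumFin-cong {ℕ.zero}  f≗g = refl
sumFin-cong {ℕ.suc n} f≗g = cong₂ ℤ._+_ (f≗g zero) (sumFin-cong (f≗g ∘ suc))

sumFin-+ : ∀ n (f g : Fin n → ℤ) →
  sumFin n (λ i → f i ℤ.+ g i) ≡ sumFin n f ℤ.+ sumFin n g
sumFin-+ n f g = trans (sumFin≡∑ n _) (trans (∑-distrib-+ f g)
  (sym (cong₂ ℤ._+_ (sumFin≡∑ n f) (sumFin≡∑ n g))))

sumFin-*ˡ : ∀ n c (f : Fin n → ℤ) → sumFin n (λ i → c ℤ.* f i) ≡ c ℤ.* sumFin n f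
sumFin-*ˡ n c f = trans (sumFin≡∑ n _) (trans (sym (*-distribˡ-sum c f))
  (cong (ℤ._*_ c) (sym (sumFin≡∑ n f))))

sumFin-*ʳ : ∀ n (f : Fin n → ℤ) c → sumFin n (λ i → f i ℤ.* c) ≡ sumFin n f ℤ.* c
sumFin-*ʳ n f c = trans (sumFin-cong λ i → ℤₚ.*-comm (f i) c)
  (trans (sumFin-*ˡ n c f) (ℤₚ.*-comm c _))

sumFin-swap : ∀ n m (f : Fin n → Fin m → ℤ) →
  sumFin n (λ i → sumFin m (f i)) ≡ sumFin m (λ j → sumFin n (λ i → f i j))
sumFin-swap n m f = begin
  sumFin n (λ i → sumFin m (f i))       ≡⟨ sumFin-cong (λ i → sumFin≡∑ m (f i)) ⟩
  sumFin n (λ i → ∑ (f i))              ≡⟨ sumFin≡∑ n _ ⟩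
  ∑ (λ i → ∑ (f i))                     ≡⟨ ∑-comm f ⟩
  ∑ (λ j → ∑ (λ i → f i j))             ≡⟨ sumFin≡∑ m _ ⟨
  sumFin m (λ j → ∑ (λ i → f i j))      ≡⟨ sumFin-cong (λ j → sumFin≡∑ n (λ i → f i j)) ⟨
  sumFin m (λ j → sumFin n (λ i → f i j)) ∎
  where open ≡-Reasoning

sumFin-0 : ∀ n → sumFin n (λ _ → + 0) ≡ + 0
sumFin-0 n = sumFin-*ˡ n (+ 0) (λ _ → + 0)

sumFin-mono : ∀ {n} {f g : Fin n → ℤ} → (∀ i → f i ℤ.≤ g i) → sumFin n f ℤ.≤ sumFin n g
sumFin-mono {ℕ.zero}  f≤g = ℤₚ.≤-refl
sumFin-mono {ℕ.suc n} f≤g = ℤₚ.+-mono-≤ (f≤g zero) (sumFin-mono (f≤g ∘ suc))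

sumFin-nonneg : ∀ {n} {f : Fin n → ℤ} → (∀ i → + 0 ℤ.≤ f i) → + 0 ℤ.≤ sumFin n f
sumFin-nonneg {n} {f} 0≤f = ℤₚ.≤-trans (ℤₚ.≤-reflexive (sym (sumFin-0 n))) (sumFin-mono 0≤f)

term≤sumFin : ∀ {n} {f : Fin n → ℤ} → (∀ i → + 0 ℤ.≤ f i) → ∀ i → f i ℤ.≤ sumFin n f
term≤sumFin {f = f} 0≤f zero    = ℤₚ.≤-trans (ℤₚ.≤-reflexive (sym (ℤₚ.+-identityʳ (f zero))))
  (ℤₚ.+-monoʳ-≤ (f zero) (sumFin-nonneg (0≤f ∘ suc)))
term≤sumFin {f = f} 0≤f (suc i) = ℤₚ.≤-trans (ℤₚ.≤-reflexive (sym (ℤₚ.+-identityˡ (f (suc i)))))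
  (ℤₚ.+-mono-≤ (0≤f zero) (term≤sumFin (0≤f ∘ suc) i))

-- The identity matrix as an indicator function.

idM-≡ : ∀ {n} {i j : Fin n} → i ≡ j → idM i j ≡ + 1
idM-≡ {i = i} {j} i≡j with i Fin.≟ j
... | yes _   = refl
... | no  i≢j = contradiction i≡j i≢j

idM-≢ : ∀ {n} {i j : Fin n} → ¬ i ≡ j → idM i j ≡ + 0
idM-≢ {i = i} {j} i≢j with i Fin.≟ j
... | yes i≡j = contradiction i≡j i≢j
... | no  _   = refl

idM-suc : ∀ {n} (i j : Fin n) → idM (suc i) (suc j) ≡ idM i j
idM-suc i j with i Fin.≟ j
... | yes i≡j = refl
... | no  i≢j = refl

idM-sym : ∀ {n} (i j : Fin n) → idM i j ≡ idM j i
idM-sym i j with i Fin.≟ j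
... | yes i≡j = sym (idM-≡ (sym i≡j))
... | no  i≢j = sym (idM-≢ (i≢j ∘ sym))

idM-nonneg : ∀ {n} (i j : Fin n) → + 0 ℤ.≤ idM i j
idM-nonneg i j with i Fin.≟ j
... | yes _ = +≤+ ℕ.z≤n
... | no  _ = +≤+ ℕ.z≤n

sumFin-idMˡ : ∀ {n} (i : Fin n) (f : Fin n → ℤ) → sumFin n (λ k → idM i k ℤ.* f k) ≡ f i
sumFin-idMˡ {ℕ.suc n} zero f = trans
  (cong₂ ℤ._+_ (ℤₚ.*-identityˡ (f zero)) (sumFin-0 n)) (ℤₚ.+-identityʳ (f zero))
sumFin-idMˡ (suc i) f = trans (ℤₚ.+-identityˡ _)
  (trans (sumFin-cong λ k → cong (ℤ._* f (suc k)) (idM-suc i k)) (sumFin-idMˡ i (f ∘ suc)))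

sumFin-idMʳ : ∀ {n} (f : Fin n → ℤ) (j : Fin n) → sumFin n (λ k → f k ℤ.* idM k j) ≡ f j
sumFin-idMʳ f j = trans (sumFin-cong λ k → trans (ℤₚ.*-comm (f k) _)
  (cong (ℤ._* f k) (idM-sym k j))) (sumFin-idMˡ j f)

sumFin-idM : ∀ {n} (i : Fin n) → sumFin n (idM i) ≡ + 1
sumFin-idM i = trans (sumFin-cong λ k → sym (ℤₚ.*-identityʳ (idM i k)))
  (sumFin-idMˡ i (λ _ → + 1))

-- Matrix algebra, with equality of matrices taken entrywise.

⊗-congʳ : ∀ {n} (L : Matrix n) {M N : Matrix n} → (∀ i j → M i j ≡ N i j) →
  ∀ i j → (L ⊗ M) i j ≡ (L ⊗ N) i j
⊗-congʳ L M≗N i j = sumFin-cong λ k → cong (ℤ._*_ (L i k)) (M≗N k j)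

⊗-congˡ : ∀ {n} {L M : Matrix n} (N : Matrix n) → (∀ i j → L i j ≡ M i j) →
  ∀ i j → (L ⊗ N) i j ≡ (M ⊗ N) i j
⊗-congˡ N L≗M i j = sumFin-cong λ k → cong (ℤ._* N k j) (L≗M i k)

⊗-assoc : ∀ {n} (L M N : Matrix n) i j → ((L ⊗ M) ⊗ N) i j ≡ (L ⊗ (M ⊗ N)) i j
⊗-assoc {n} L M N i j = begin
  sumFin n (λ k → sumFin n (λ l → L i l ℤ.* M l k) ℤ.* N k j)
    ≡⟨ sumFin-cong (λ k → sumFin-*ʳ n (λ l → L i l ℤ.* M l k) (N k j)) ⟨
  sumFin n (λ k → sumFin n (λ l → L i l ℤ.* M l k ℤ.* N k j))
    ≡⟨ sumFin-swap n n (λ k l → L i l ℤ.* M l k ℤ.* N k j) ⟩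
  sumFin n (λ l → sumFin n (λ k → L i l ℤ.* M l k ℤ.* N k j))
    ≡⟨ sumFin-cong (λ l → sumFin-cong λ k → ℤₚ.*-assoc (L i l) (M l k) (N k j)) ⟩
  sumFin n (λ l → sumFin n (λ k → L i l ℤ.* (M l k ℤ.* N k j)))
    ≡⟨ sumFin-cong (λ l → sumFin-*ˡ n (L i l) (λ k → M l k ℤ.* N k j)) ⟩
  sumFin n (λ l → L i l ℤ.* sumFin n (λ k → M l k ℤ.* N k j)) ∎
  where open ≡-Reasoning

⊗-distribˡ-⊕ : ∀ {n} (L M N : Matrix n) i j →
  (L ⊗ (M ⊕ N)) i j ≡ (L ⊗ M) i j ℤ.+ (L ⊗ N) i j
⊗-distribˡ-⊕ {n} L M N i j = trans
  (sumFin-cong λ k → ℤₚ.*-distribˡ-+ (L i k) (M k j) (N k j)) (sumFin-+ n _ _)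

⊗-distribʳ-⊕ : ∀ {n} (L M N : Matrix n) i j →
  ((L ⊕ M) ⊗ N) i j ≡ (L ⊗ N) i j ℤ.+ (M ⊗ N) i j
⊗-distribʳ-⊕ {n} L M N i j = trans
  (sumFin-cong λ k → ℤₚ.*-distribʳ-+ (N k j) (L i k) (M i k)) (sumFin-+ n _ _)

⊗-·Mʳ : ∀ {n} c (L M : Matrix n) i j → (L ⊗ (c ·M M)) i j ≡ c ℤ.* (L ⊗ M) i j
⊗-·Mʳ {n} c L M i j = trans
  (sumFin-cong λ k → x*[c*y]≡c*[x*y] (L i k) c (M k j)) (sumFin-*ˡ n c _)
  where
  x*[c*y]≡c*[x*y] : ∀ x c y → x ℤ.* (c ℤ.* y) ≡ c ℤ.* (x ℤ.* y)
  x*[c*y]≡c*[x*y] = solve-∀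

⊗-·Mˡ : ∀ {n} c (L M : Matrix n) i j → ((c ·M L) ⊗ M) i j ≡ c ℤ.* (L ⊗ M) i j
⊗-·Mˡ {n} c L M i j = trans
  (sumFin-cong λ k → ℤₚ.*-assoc c (L i k) (M k j)) (sumFin-*ˡ n c _)

-- Polynomials evaluated at a matrix.

-- Induction along Horner's scheme: scalar matrices commute with `A`, and A(AE) = A(EA) = (AE)A for
-- the value E of the tail.
evalM-commutes : ∀ {n} p (A : Matrix n) i j → (A ⊗ evalM p A) i j ≡ (evalM p A ⊗ A) i j
evalM-commutes List.[] A i j = sumFin-cong λ k → ℤₚ.*-comm (A i k) (+ 0)
evalM-commutes {n} (c List.∷ p) A i j = begin
  (A ⊗ (cI ⊕ (A ⊗ E))) i j
    ≡⟨ ⊗-distribˡ-⊕ A cI (A ⊗ E) i j ⟩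
  (A ⊗ cI) i j ℤ.+ (A ⊗ (A ⊗ E)) i j
    ≡⟨ cong₂ ℤ._+_ scalar
         (trans (⊗-congʳ A (evalM-commutes p A) i j) (sym (⊗-assoc A E A i j))) ⟩
  (cI ⊗ A) i j ℤ.+ ((A ⊗ E) ⊗ A) i j
    ≡⟨ ⊗-distribʳ-⊕ cI (A ⊗ E) A i j ⟨
  ((cI ⊕ (A ⊗ E)) ⊗ A) i j ∎
  where
  open ≡-Reasoning
  E cI : Matrix n
  E  = evalM p A
  cI = c ·M idM

  scalar : (A ⊗ cI) i j ≡ (cI ⊗ A) i j
  scalar = begin
    (A ⊗ cI) i j          ≡⟨ ⊗-·Mʳ c A idM i j ⟩
    c ℤ.* (A ⊗ idM) i j   ≡⟨ cong (ℤ._*_ c) (sumFin-idMʳ (A i) j) ⟩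
    c ℤ.* A i j           ≡⟨ cong (ℤ._*_ c) (sumFin-idMˡ i (λ k → A k j)) ⟨
    c ℤ.* (idM ⊗ A) i j   ≡⟨ ⊗-·Mˡ c idM A i j ⟨
    (cI ⊗ A) i j          ∎

evalM-+P : ∀ {n} p q (A : Matrix n) i j → evalM (p +P q) A i j ≡ evalM p A i j ℤ.+ evalM q A i j
evalM-+P List.[] q A i j = sym (ℤₚ.+-identityˡ _)
evalM-+P (a List.∷ p) List.[] A i j = sym (ℤₚ.+-identityʳ _)
evalM-+P (a List.∷ p) (b List.∷ q) A i j = trans
  (cong (ℤ._+_ ((a ℤ.+ b) ℤ.* idM i j)) (trans
    (⊗-congʳ A (evalM-+P p q A) i j) (⊗-distribˡ-⊕ A (evalM p A) (evalM q A) i j)))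
  (rearrange a b (idM i j) _ _)
  where
  rearrange : ∀ a b x y z →
    (a ℤ.+ b) ℤ.* x ℤ.+ (y ℤ.+ z) ≡ (a ℤ.* x ℤ.+ y) ℤ.+ (b ℤ.* x ℤ.+ z)
  rearrange = solve-∀

evalM-·P : ∀ {n} c p (A : Matrix n) i j → evalM (c ·P p) A i j ≡ c ℤ.* evalM p A i j
evalM-·P c List.[] A i j = sym (ℤₚ.*-zeroʳ c)
evalM-·P c (a List.∷ p) A i j = trans
  (cong (ℤ._+_ (c ℤ.* a ℤ.* idM i j)) (trans
    (⊗-congʳ A (evalM-·P c p A) i j) (⊗-·Mʳ c A (evalM p A) i j)))
  (rearrange c a (idM i j) _)
  where
  rearrange : ∀ c a x y → c ℤ.* a ℤ.* x ℤ.+ c ℤ.* y ≡ c ℤ.* (a ℤ.* x ℤ.+ y)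
  rearrange = solve-∀

-- The recurrence of the polynomials G at a matrix.

GM : ∀ {n} → ℕ → ℕ → Matrix n → Matrix n
GM d m A = evalM (Gpoly d m) A

GM-0 : ∀ {n} d (A : Matrix n) i j → GM d 0 A i j ≡ idM i j
GM-0 {n} d A i j = trans (cong₂ ℤ._+_ (ℤₚ.*-identityˡ (idM i j))
  (trans (sumFin-cong λ k → ℤₚ.*-zeroʳ (A i k)) (sumFin-0 n))) (ℤₚ.+-identityʳ _)

GM-1 : ∀ {n} d (A : Matrix n) i j → GM d 1 A i j ≡ idM i j ℤ.+ A i j
GM-1 d A i j = cong₂ ℤ._+_ (ℤₚ.*-identityˡ (idM i j))
  (trans (⊗-congʳ A (GM-0 d A) i j) (sumFin-idMʳ (A i) j))

-- With the parameter written as `suc d`, the truncated subtraction in `Gpoly` reduces to `d`.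
GM-suc-suc : ∀ {n} d m (A : Matrix n) i j →
  GM (ℕ.suc d) (ℕ.suc (ℕ.suc m)) A i j
    ≡ (A ⊗ GM (ℕ.suc d) (ℕ.suc m) A) i j ℤ.- + d ℤ.* GM (ℕ.suc d) m A i j
GM-suc-suc d m A i j = trans
  (evalM-+P (xP p) ((- (+ d)) ·P q) A i j)
  (cong₂ ℤ._+_ (ℤₚ.+-identityˡ ((A ⊗ evalM p A) i j))
    (trans (evalM-·P (- (+ d)) q A i j) (sym (ℤₚ.neg-distribˡ-* (+ d) (evalM q A i j)))))
  where
  p = Gpoly (ℕ.suc d) (ℕ.suc m)
  q = Gpoly (ℕ.suc d) m

-- Regular graphs and non-backtracking walks.

sumFin-pos : ∀ n (f : Fin n → ℕ) → sumFin n (λ i → + f i) ≡ + sum (tabulate f)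
sumFin-pos ℕ.zero    f = refl
sumFin-pos (ℕ.suc n) f = cong (ℤ._+_ (+ f zero)) (sumFin-pos n (f ∘ suc))

-- The degree is `suc d`, so `d` is the number of ways to continue a walk without turning back.
module RegularGraph {n : ℕ} (G : Graph n) (d : ℕ) (regular : Regular G (ℕ.suc d)) where

  A : Matrix n
  A = adjMatrix G

  Adjacent : Fin n → Fin n → Set
  Adjacent u v = adj G u v ≡ true

  Adjacent-sym : ∀ {u v} → Adjacent u v → Adjacent v u
  Adjacent-sym {u} {v} u~v = trans (adj-sym G v u) u~v

  A-adjacent : ∀ {u v} → Adjacent u v → A u v ≡ + 1
  A-adjacent u~v rewrite u~v = refl

  A≡1⇒Adjacent : ∀ u v → A u v ≡ + 1 → Adjacent u v
  A≡1⇒Adjacent u v eq with adj G u v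
  ... | true = refl

  A-0or1 : ∀ u v → A u v ≡ + 0 ⊎ A u v ≡ + 1
  A-0or1 u v with adj G u v
  ... | true  = inj₂ refl
  ... | false = inj₁ refl

  A-sym : ∀ u v → A u v ≡ A v u
  A-sym u v = cong (λ b → if b then + 1 else + 0) (adj-sym G u v)

  A-diagonal : ∀ u → A u u ≡ + 0
  A-diagonal u rewrite irrefl G u = refl

  A-nonneg : ∀ u v → + 0 ℤ.≤ A u v
  A-nonneg u v with adj G u v
  ... | true  = +≤+ ℕ.z≤n
  ... | false = +≤+ ℕ.z≤n

  A-idem : ∀ u v → A u v ℤ.* A u v ≡ A u v
  A-idem u v with adj G u v
  ... | true  = refl
  ... | false = refl

  A-row : ∀ u → sumFin n (A u) ≡ + ℕ.suc d
  A-row u = begin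
    sumFin n (A u)              ≡⟨ sumFin-cong (λ v → if-pos (adj G u v)) ⟩
    sumFin n (λ v → + entry v)  ≡⟨ sumFin-pos n entry ⟩
    + sum (tabulate entry)      ≡⟨ cong (λ l → + sum l) (map-tabulate (λ v → v) entry) ⟨
    + degree G u                ≡⟨ cong +_ (regular u) ⟩
    + ℕ.suc d                   ∎
    where
    open ≡-Reasoning
    entry : Fin n → ℕ
    entry v = if adj G u v then 1 else 0
    if-pos : ∀ b → (if b then + 1 else + 0) ≡ + (if b then 1 else 0)
    if-pos true  = refl
    if-pos false = refl

  A-column : ∀ v → sumFin n (λ u → A u v) ≡ + ℕ.suc d
  A-column v = trans (sumFin-cong λ u → A-sym u v) (A-row v)

  -- The indicator of `s` and `t` has sum 2 and is dominated by `A u w * A w v`.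
  two-paths : ∀ {u v s t} → ¬ s ≡ t → Adjacent u s → Adjacent s v → Adjacent u t → Adjacent t v →
    + 2 ℤ.≤ (A ⊗ A) u v
  two-paths {u} {v} {s} {t} s≢t u~s s~v u~t t~v = ℤₚ.≤-trans
    (ℤₚ.≤-reflexive (sym (trans (sumFin-+ n (idM s) (idM t))
      (cong₂ ℤ._+_ (sumFin-idM s) (sumFin-idM t)))))
    (sumFin-mono bound)
    where
    bound : ∀ w → idM s w ℤ.+ idM t w ℤ.≤ A u w ℤ.* A w v
    bound w with s Fin.≟ w | t Fin.≟ w
    ... | yes refl | yes refl = contradiction refl s≢t
    ... | yes refl | no _     rewrite u~s | s~v = ℤₚ.≤-refl
    ... | no _     | yes refl rewrite u~t | t~v = ℤₚ.≤-refl
    ... | no _     | no _     with adj G u w | adj G w v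
    ...   | true  | true  = +≤+ ℕ.z≤n
    ...   | true  | false = +≤+ ℕ.z≤n
    ...   | false | true  = +≤+ ℕ.z≤n
    ...   | false | false = +≤+ ℕ.z≤n

  -- Discarding `x` and `y` costs at most two of the `suc d` neighbours of `s`; every other
  -- neighbour contributes at least 1 to the sum of `f`.
  degree-bound : ∀ (f : Fin n → ℤ) → (∀ v → + 0 ℤ.≤ f v) → ∀ s x y →
    (∀ v → Adjacent s v → ¬ x ≡ v → ¬ y ≡ v → + 1 ℤ.≤ f v) →
    + ℕ.suc d ℤ.≤ sumFin n f ℤ.+ + 2
  degree-bound f 0≤f s x y 1≤f = ℤₚ.≤-trans (ℤₚ.≤-reflexive (sym (A-row s)))
    (ℤₚ.≤-trans (sumFin-mono bound) (ℤₚ.≤-reflexive (trans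
      (sumFin-+ n f (λ v → idM x v ℤ.+ idM y v))
      (cong (ℤ._+_ (sumFin n f)) (trans (sumFin-+ n (idM x) (idM y))
        (cong₂ ℤ._+_ (sumFin-idM x) (sumFin-idM y)))))))
    where
    A≤1 : ∀ v → A s v ℤ.≤ + 1
    A≤1 v with adj G s v
    ... | true  = ℤₚ.≤-refl
    ... | false = +≤+ ℕ.z≤n

    bound : ∀ v → A s v ℤ.≤ f v ℤ.+ (idM x v ℤ.+ idM y v)
    bound v with x Fin.≟ v | y Fin.≟ v
    ... | yes _   | yes _   = ℤₚ.≤-trans (A≤1 v) (ℤₚ.+-mono-≤ (0≤f v) (+≤+ (ℕ.s≤s ℕ.z≤n)))
    ... | yes _   | no  _   = ℤₚ.≤-trans (A≤1 v) (ℤₚ.+-mono-≤ (0≤f v) ℤₚ.≤-refl)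
    ... | no  _   | yes _   = ℤₚ.≤-trans (A≤1 v) (ℤₚ.+-mono-≤ (0≤f v) ℤₚ.≤-refl)
    ... | no  x≢v | no  y≢v with adj G s v in s~v
    ...   | true  = ℤₚ.+-mono-≤ (1≤f v s~v x≢v y≢v) (ℤₚ.≤-refl {+ 0})
    ...   | false = ℤₚ.+-mono-≤ (0≤f v) (ℤₚ.≤-refl {+ 0})

  -- NB m u w v counts the non-backtracking walks of length 1 + m from u to v with first step u w.
  NB : ℕ → Fin n → Fin n → Fin n → ℤ
  NB ℕ.zero    u w v = A u w ℤ.* idM w v
  NB (ℕ.suc m) u w v = A u w ℤ.* (sumFin n (λ x → NB m w x v) ℤ.- NB m w u v)

  -- With the first step summed out, this counts all non-backtracking walks of length `1 + m`.
  F : ℕ → Matrix n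
  F m u v = sumFin n (λ w → NB m u w v)

  NB-nonneg : ∀ m u w v → + 0 ℤ.≤ NB m u w v
  NB-nonneg ℕ.zero u w v with adj G u w
  ... | true  = ℤₚ.≤-trans (idM-nonneg w v) (ℤₚ.≤-reflexive (sym (ℤₚ.*-identityˡ _)))
  ... | false = ℤₚ.≤-refl
  NB-nonneg (ℕ.suc m) u w v with adj G u w
  -- The subtracted number is one of the terms of the sum.
  ... | true  = ℤₚ.≤-trans (ℤₚ.i≤j⇒0≤j-i (term≤sumFin (λ x → NB-nonneg m w x v) u))
    (ℤₚ.≤-reflexive (sym (ℤₚ.*-identityˡ _)))
  ... | false = ℤₚ.≤-refl

  A*A* : ∀ u w x → A u w ℤ.* (A u w ℤ.* x) ≡ A u w ℤ.* x
  A*A* u w x = trans (sym (ℤₚ.*-assoc (A u w) (A u w) x)) (cong (ℤ._* x) (A-idem u w))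

  A*NB : ∀ m u w v → A u w ℤ.* NB m u w v ≡ NB m u w v
  A*NB ℕ.zero    u w v = A*A* u w (idM w v)
  A*NB (ℕ.suc m) u w v = A*A* u w (F m w v ℤ.- NB m w u v)

  F-0 : ∀ u v → F 0 u v ≡ A u v
  F-0 u v = sumFin-idMʳ (A u) v

  -- A walk of length 2 backtracks exactly when it returns to its start, once for each of the
  -- `suc d` neighbours. The factor is not yet `d`, because a walk of length 0 has no first step.
  F-1 : ∀ u v → F 1 u v ≡ (A ⊗ A) u v ℤ.- + ℕ.suc d ℤ.* idM u v
  F-1 u v = begin
    F 1 u v
      ≡⟨ sumFin-cong term ⟩
    sumFin n (λ w → A u w ℤ.* A w v ℤ.+ A u w ℤ.* (- idM u v))
      ≡⟨ sumFin-+ n (λ w → A u w ℤ.* A w v) (λ w → A u w ℤ.* (- idM u v)) ⟩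
    (A ⊗ A) u v ℤ.+ sumFin n (λ w → A u w ℤ.* (- idM u v))
      ≡⟨ cong (ℤ._+_ ((A ⊗ A) u v)) (trans (sumFin-*ʳ n (A u) _) (cong (ℤ._* _) (A-row u))) ⟩
    (A ⊗ A) u v ℤ.+ + ℕ.suc d ℤ.* (- idM u v)
      ≡⟨ cong (ℤ._+_ ((A ⊗ A) u v)) (ℤₚ.neg-distribʳ-* (+ ℕ.suc d) (idM u v)) ⟨
    (A ⊗ A) u v ℤ.- + ℕ.suc d ℤ.* idM u v ∎
    where
    open ≡-Reasoning
    expand : ∀ a f i → a ℤ.* (f ℤ.- a ℤ.* i) ≡ a ℤ.* f ℤ.+ (a ℤ.* a) ℤ.* (- i)
    expand = solve-∀
    term : ∀ w → NB 1 u w v ≡ A u w ℤ.* A w v ℤ.+ A u w ℤ.* (- idM u v)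
    term w = begin
      A u w ℤ.* (F 0 w v ℤ.- A w u ℤ.* idM u v)
        ≡⟨ cong₂ (λ x y → A u w ℤ.* (x ℤ.- y ℤ.* idM u v)) (F-0 w v) (A-sym w u) ⟩
      A u w ℤ.* (A w v ℤ.- A u w ℤ.* idM u v)
        ≡⟨ expand (A u w) (A w v) (idM u v) ⟩
      A u w ℤ.* A w v ℤ.+ (A u w ℤ.* A u w) ℤ.* (- idM u v)
        ≡⟨ cong (λ x → A u w ℤ.* A w v ℤ.+ x ℤ.* (- idM u v)) (A-idem u w) ⟩
      A u w ℤ.* A w v ℤ.+ A u w ℤ.* (- idM u v) ∎

  -- Prepending the edge `u w` fails exactly for walks that return at once to `u` and then do not
  -- start with `w`. A walk counted by `F m u v` is thus removed once for each neighbour of `u`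
  -- except its own first step, `d` times in all.
  F-suc-suc : ∀ m u v → F (ℕ.suc (ℕ.suc m)) u v ≡ (A ⊗ F (ℕ.suc m)) u v ℤ.- + d ℤ.* F m u v
  F-suc-suc m u v = begin
    F (ℕ.suc (ℕ.suc m)) u v
      ≡⟨ sumFin-cong term ⟩
    sumFin n (λ w → A u w ℤ.* F (ℕ.suc m) w v ℤ.+ (NB m u w v ℤ.+ A u w ℤ.* (- F m u v)))
      ≡⟨ sumFin-+ n (λ w → A u w ℤ.* F (ℕ.suc m) w v) _ ⟩
    (A ⊗ F (ℕ.suc m)) u v ℤ.+ sumFin n (λ w → NB m u w v ℤ.+ A u w ℤ.* (- F m u v))
      ≡⟨ cong (ℤ._+_ ((A ⊗ F (ℕ.suc m)) u v)) (sumFin-+ n (λ w → NB m u w v) _) ⟩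
    (A ⊗ F (ℕ.suc m)) u v ℤ.+ (F m u v ℤ.+ sumFin n (λ w → A u w ℤ.* (- F m u v)))
      ≡⟨ cong (λ x → (A ⊗ F (ℕ.suc m)) u v ℤ.+ (F m u v ℤ.+ x))
           (trans (sumFin-*ʳ n (A u) _) (cong (ℤ._* (- F m u v)) (A-row u))) ⟩
    (A ⊗ F (ℕ.suc m)) u v ℤ.+ (F m u v ℤ.+ (+ 1 ℤ.+ + d) ℤ.* (- F m u v))
      ≡⟨ collect ((A ⊗ F (ℕ.suc m)) u v) (F m u v) (+ d) ⟩
    (A ⊗ F (ℕ.suc m)) u v ℤ.- + d ℤ.* F m u v ∎
    where
    open ≡-Reasoning
    collect : ∀ x f d → x ℤ.+ (f ℤ.+ (+ 1 ℤ.+ d) ℤ.* (- f)) ≡ x ℤ.- d ℤ.* f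
    collect = solve-∀
    expand : ∀ a x f y →
      a ℤ.* (x ℤ.- a ℤ.* (f ℤ.- y)) ≡ a ℤ.* x ℤ.+ ((a ℤ.* a) ℤ.* y ℤ.+ (a ℤ.* a) ℤ.* (- f))
    expand = solve-∀
    term : ∀ w → NB (ℕ.suc (ℕ.suc m)) u w v
      ≡ A u w ℤ.* F (ℕ.suc m) w v ℤ.+ (NB m u w v ℤ.+ A u w ℤ.* (- F m u v))
    term w = begin
      A u w ℤ.* (F (ℕ.suc m) w v ℤ.- A w u ℤ.* (F m u v ℤ.- NB m u w v))
        ≡⟨ cong (λ x → A u w ℤ.* (F (ℕ.suc m) w v ℤ.- x ℤ.* (F m u v ℤ.- NB m u w v))) (A-sym w u) ⟩
      A u w ℤ.* (F (ℕ.suc m) w v ℤ.- A u w ℤ.* (F m u v ℤ.- NB m u w v))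
        ≡⟨ expand (A u w) (F (ℕ.suc m) w v) (F m u v) (NB m u w v) ⟩
      A u w ℤ.* F (ℕ.suc m) w v
        ℤ.+ ((A u w ℤ.* A u w) ℤ.* NB m u w v ℤ.+ (A u w ℤ.* A u w) ℤ.* (- F m u v))
        ≡⟨ cong (λ x → A u w ℤ.* F (ℕ.suc m) w v ℤ.+ (x ℤ.* NB m u w v ℤ.+ x ℤ.* (- F m u v)))
             (A-idem u w) ⟩
      A u w ℤ.* F (ℕ.suc m) w v ℤ.+ (A u w ℤ.* NB m u w v ℤ.+ A u w ℤ.* (- F m u v))
        ≡⟨ cong (λ x → A u w ℤ.* F (ℕ.suc m) w v ℤ.+ (x ℤ.+ A u w ℤ.* (- F m u v)))
             (A*NB m u w v) ⟩
      A u w ℤ.* F (ℕ.suc m) w v ℤ.+ (NB m u w v ℤ.+ A u w ℤ.* (- F m u v)) ∎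

  H : ℕ → Matrix n
  H m = GM (ℕ.suc d) m A

  H-2 : ∀ u v → H 2 u v ≡ A u v ℤ.+ (A ⊗ A) u v ℤ.- + d ℤ.* idM u v
  H-2 u v = begin
    H 2 u v
      ≡⟨ GM-suc-suc d 0 A u v ⟩
    (A ⊗ H 1) u v ℤ.- + d ℤ.* H 0 u v
      ≡⟨ cong₂ (λ x y → x ℤ.- + d ℤ.* y)
           (trans (⊗-congʳ A (GM-1 (ℕ.suc d) A) u v) (⊗-distribˡ-⊕ A idM A u v))
           (GM-0 (ℕ.suc d) A u v) ⟩
    (A ⊗ idM) u v ℤ.+ (A ⊗ A) u v ℤ.- + d ℤ.* idM u v
      ≡⟨ cong (λ x → x ℤ.+ (A ⊗ A) u v ℤ.- + d ℤ.* idM u v) (sumFin-idMʳ (A u) v) ⟩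
    A u v ℤ.+ (A ⊗ A) u v ℤ.- + d ℤ.* idM u v ∎
    where open ≡-Reasoning

  -- From `m = 2` on, both sides follow the same recurrence. Hence `H m` counts the non-backtracking
  -- walks of length at most `m`.
  H-suc : ∀ m u v → H (ℕ.suc m) u v ≡ H m u v ℤ.+ F m u v
  H-suc 0 u v = trans (GM-1 (ℕ.suc d) A u v)
    (sym (cong₂ ℤ._+_ (GM-0 (ℕ.suc d) A u v) (F-0 u v)))
  H-suc 1 u v = trans (H-2 u v) (trans (rearrange (A u v) ((A ⊗ A) u v) (idM u v) (+ d))
    (sym (cong₂ ℤ._+_ (GM-1 (ℕ.suc d) A u v) (F-1 u v))))
    where
    rearrange : ∀ a b i d →
      a ℤ.+ b ℤ.- d ℤ.* i ≡ (i ℤ.+ a) ℤ.+ (b ℤ.- (+ 1 ℤ.+ d) ℤ.* i)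
    rearrange = solve-∀
  H-suc (ℕ.suc (ℕ.suc m)) u v = begin
    H (ℕ.suc (ℕ.suc (ℕ.suc m))) u v
      ≡⟨ GM-suc-suc d (ℕ.suc m) A u v ⟩
    (A ⊗ H (ℕ.suc (ℕ.suc m))) u v ℤ.- + d ℤ.* H (ℕ.suc m) u v
      ≡⟨ cong₂ (λ x y → x ℤ.- + d ℤ.* y)
           (trans (⊗-congʳ A (H-suc (ℕ.suc m)) u v)
             (⊗-distribˡ-⊕ A (H (ℕ.suc m)) (F (ℕ.suc m)) u v))
           (H-suc m u v) ⟩
    (A ⊗ H (ℕ.suc m)) u v ℤ.+ (A ⊗ F (ℕ.suc m)) u v ℤ.- + d ℤ.* (H m u v ℤ.+ F m u v)
      ≡⟨ rearrange ((A ⊗ H (ℕ.suc m)) u v) ((A ⊗ F (ℕ.suc m)) u v) (H m u v) (F m u v) (+ d) ⟩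
    ((A ⊗ H (ℕ.suc m)) u v ℤ.- + d ℤ.* H m u v)
      ℤ.+ ((A ⊗ F (ℕ.suc m)) u v ℤ.- + d ℤ.* F m u v)
      ≡⟨ cong₂ ℤ._+_ (GM-suc-suc d m A u v) (F-suc-suc m u v) ⟨
    H (ℕ.suc (ℕ.suc m)) u v ℤ.+ F (ℕ.suc (ℕ.suc m)) u v ∎
    where
    open ≡-Reasoning
    rearrange : ∀ x y h f d →
      x ℤ.+ y ℤ.- d ℤ.* (h ℤ.+ f) ≡ (x ℤ.- d ℤ.* h) ℤ.+ (y ℤ.- d ℤ.* f)
    rearrange = solve-∀

  H-mono : ∀ m u v → H 2 u v ℤ.≤ H (ℕ.suc (ℕ.suc m)) u v
  H-mono ℕ.zero    u v = ℤₚ.≤-refl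
  H-mono (ℕ.suc m) u v = ℤₚ.≤-trans (H-mono m u v) (ℤₚ.≤-trans
    (ℤₚ.≤-reflexive (sym (ℤₚ.+-identityʳ _)))
    (ℤₚ.≤-trans
      (ℤₚ.+-monoʳ-≤ (H (ℕ.suc (ℕ.suc m)) u v)
        (sumFin-nonneg λ w → NB-nonneg (ℕ.suc (ℕ.suc m)) u w v))
      (ℤₚ.≤-reflexive (sym (H-suc (ℕ.suc (ℕ.suc m)) u v)))))

  -- Since `u` and `v` differ, the negative term of `H 2` vanishes, and both two-step paths remain
  -- counted for every larger index.
  two-paths⇒2≤H : ∀ m {u v s t} → ¬ u ≡ v → ¬ s ≡ t →
    Adjacent u s → Adjacent s v → Adjacent u t → Adjacent t v →
    + 2 ℤ.≤ H (ℕ.suc (ℕ.suc m)) u v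
  two-paths⇒2≤H m {u} {v} u≢v s≢t u~s s~v u~t t~v = begin
    + 2                                       ≤⟨ two-paths s≢t u~s s~v u~t t~v ⟩
    (A ⊗ A) u v                               ≡⟨ ℤₚ.+-identityˡ _ ⟨
    + 0 ℤ.+ (A ⊗ A) u v                       ≤⟨ ℤₚ.+-monoˡ-≤ ((A ⊗ A) u v) (A-nonneg u v) ⟩
    A u v ℤ.+ (A ⊗ A) u v                     ≡⟨ drop (A u v ℤ.+ (A ⊗ A) u v) (+ d) ⟨
    A u v ℤ.+ (A ⊗ A) u v ℤ.- + d ℤ.* + 0     ≡⟨ cong (λ x → A u v ℤ.+ (A ⊗ A) u v ℤ.- + d ℤ.* x)
                                                   (idM-≢ u≢v) ⟨
    A u v ℤ.+ (A ⊗ A) u v ℤ.- + d ℤ.* idM u v ≡⟨ H-2 u v ⟨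
    H 2 u v                                   ≤⟨ H-mono m u v ⟩
    H (ℕ.suc (ℕ.suc m)) u v                   ∎
    where
    open ℤₚ.≤-Reasoning
    drop : ∀ x d → x ℤ.- d ℤ.* + 0 ≡ x
    drop = solve-∀

-- Positions along the cycle, read modulo its length.

next-right-unique : ∀ {n} {i j j′ : Fin n} → Next i j → Next i j′ → j ≡ j′
next-right-unique (inj₁ p)       (inj₁ q)       = Fin.toℕ-injective (trans p (sym q))
next-right-unique (inj₂ (_ , p)) (inj₂ (_ , q)) = Fin.toℕ-injective (trans p (sym q))
next-right-unique {j = j} (inj₁ p) (inj₂ (q , _)) =
  contradiction (trans p q) (ℕ.<⇒≢ (Fin.toℕ<n j))
next-right-unique {j′ = j′} (inj₂ (q , _)) (inj₁ p) =
  contradiction (trans p q) (ℕ.<⇒≢ (Fin.toℕ<n j′))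

next-left-unique : ∀ {n} {i i′ j : Fin n} → Next i j → Next i′ j → i ≡ i′
next-left-unique (inj₁ p)       (inj₁ q)       = Fin.toℕ-injective (ℕ.suc-injective (trans (sym p) q))
next-left-unique (inj₂ (p , _)) (inj₂ (q , _)) = Fin.toℕ-injective (ℕ.suc-injective (trans p (sym q)))
next-left-unique (inj₁ p)       (inj₂ (_ , q)) = contradiction (trans (sym p) q) λ ()
next-left-unique (inj₂ (_ , q)) (inj₁ p)       = contradiction (trans (sym p) q) λ ()

module CyclicLabelling {k : ℕ} (σ : Fin (3 ℕ.+ k) ↔ Fin (3 ℕ.+ k)) where

  open Inverse σ using (to; from; strictlyInverseˡ)

  N : ℕ
  N = 3 ℕ.+ k

  -- The vertices in cyclic order, continued periodically to all naturals, so that positions can be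
  -- added without reduction.
  e : ℕ → Fin N
  e x = to (x mod N)

  mod≡⇒%≡ : ∀ x y → x mod N ≡ y mod N → x % N ≡ y % N
  mod≡⇒%≡ x y eq = trans (sym (Fin.toℕ-fromℕ< _)) (trans (cong Fin.toℕ eq) (Fin.toℕ-fromℕ< _))

  %≡⇒mod≡ : ∀ x y → x % N ≡ y % N → x mod N ≡ y mod N
  %≡⇒mod≡ x y eq = Fin.fromℕ<-cong (x % N) (y % N) eq (m%n<n x N) (m%n<n y N)

  e-injective : ∀ x y → e x ≡ e y → x mod N ≡ y mod N
  e-injective x y eq = Injection.injective (↔⇒↣ σ) eq

  -- Adding `c * (N - 1)` undoes a shift by `c`, which replaces subtraction of positions.
  e-periodic : ∀ c x → e (c ℕ.* (2 ℕ.+ k) ℕ.+ (c ℕ.+ x)) ≡ e x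
  e-periodic c x = cong to (%≡⇒mod≡ (c ℕ.* (2 ℕ.+ k) ℕ.+ (c ℕ.+ x)) x
    (trans (cong (_% N) (rearrange c k x)) ([m+kn]%n≡m%n x c N)))
    where
    rearrange : ∀ c k x → c ℕ.* (2 ℕ.+ k) ℕ.+ (c ℕ.+ x) ≡ x ℕ.+ c ℕ.* (3 ℕ.+ k)
    rearrange = ℕ-solver.solve-∀

  e-shift : ∀ c {x y} → e x ≡ e y → e (c ℕ.+ x) ≡ e (c ℕ.+ y)
  e-shift c {x} {y} eq = cong to (%≡⇒mod≡ (c ℕ.+ x) (c ℕ.+ y) (begin
    (c ℕ.+ x) % N           ≡⟨ %-distribˡ-+ c x N ⟩
    (c % N ℕ.+ x % N) % N   ≡⟨ cong (λ z → (c % N ℕ.+ z) % N) (mod≡⇒%≡ x y (e-injective x y eq)) ⟩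
    (c % N ℕ.+ y % N) % N   ≡⟨ %-distribˡ-+ c y N ⟨
    (c ℕ.+ y) % N           ∎))
    where open ≡-Reasoning

  e-unshift : ∀ c {x y} → e (c ℕ.+ x) ≡ e (c ℕ.+ y) → e x ≡ e y
  e-unshift c {x} {y} eq = trans (sym (e-periodic c x))
    (trans (e-shift (c ℕ.* (2 ℕ.+ k)) {c ℕ.+ x} {c ℕ.+ y} eq) (e-periodic c y))

  e-from : ∀ v → e (Fin.toℕ (from v)) ≡ v
  e-from v = trans (cong to (Fin.toℕ-injective (trans (Fin.toℕ-fromℕ< _)
    (m<n⇒m%n≡m (Fin.toℕ<n (from v)))))) (strictlyInverseˡ v)

  -- The offset `c` allows a vertex to be matched directly with a position of the form `c + x`.
  e-surjective : ∀ c v → ∃ λ x → e (c ℕ.+ x) ≡ v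
  e-surjective c v = c ℕ.* (2 ℕ.+ k) ℕ.+ Fin.toℕ (from v) , trans
    (cong e (rearrange c (c ℕ.* (2 ℕ.+ k)) (Fin.toℕ (from v))))
    (trans (e-periodic c (Fin.toℕ (from v))) (e-from v))
    where
    rearrange : ∀ a b c → a ℕ.+ (b ℕ.+ c) ≡ b ℕ.+ (a ℕ.+ c)
    rearrange = ℕ-solver.solve-∀

  next-mod : ∀ x → Next (x mod N) (ℕ.suc x mod N)
  next-mod x with ℕ.suc (x % N) ℕ.<? N
  ... | yes 1+r<N = inj₁ (begin
    Fin.toℕ (ℕ.suc x mod N)    ≡⟨ Fin.toℕ-fromℕ< _ ⟩
    ℕ.suc x % N                ≡⟨ %-distribˡ-+ 1 x N ⟩
    ℕ.suc (x % N) % N          ≡⟨ m<n⇒m%n≡m 1+r<N ⟩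
    ℕ.suc (x % N)              ≡⟨ cong ℕ.suc (Fin.toℕ-fromℕ< _) ⟨
    ℕ.suc (Fin.toℕ (x mod N))  ∎)
    where open ≡-Reasoning
  ... | no 1+r≮N = inj₂ (trans (cong ℕ.suc (Fin.toℕ-fromℕ< _)) 1+r≡N , (begin
    Fin.toℕ (ℕ.suc x mod N)    ≡⟨ Fin.toℕ-fromℕ< _ ⟩
    ℕ.suc x % N                ≡⟨ %-distribˡ-+ 1 x N ⟩
    ℕ.suc (x % N) % N          ≡⟨ cong (_% N) 1+r≡N ⟩
    N % N                      ≡⟨ n%n≡0 N ⟩
    0                          ∎))
    where
    open ≡-Reasoning
    1+r≡N = ℕ.≤-antisym (m%n<n x N) (ℕ.≮⇒≥ 1+r≮N)

  consec-mod : ∀ x {j} → Consec (ℕ.suc x mod N) j → x mod N ≡ j ⊎ ℕ.suc (ℕ.suc x) mod N ≡ j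
  consec-mod x (inj₁ p) = inj₂ (next-right-unique (next-mod (ℕ.suc x)) p)
  consec-mod x (inj₂ p) = inj₁ (next-left-unique (next-mod x) p)

  -- The length is at least 3, so 0 and 2 have different remainders.
  e-2-apart : ∀ x → ¬ e x ≡ e (ℕ.suc (ℕ.suc x))
  e-2-apart x eq = contradiction (mod≡⇒%≡ 0 2 (e-injective 0 2 (e-unshift x {0} {2}
    (trans (cong e (ℕ.+-identityʳ x)) (trans eq (cong e (ℕ.+-comm 2 x))))))) λ ()

  -- The two neighbours of a position are distinct, so their indicators never add up to 2. Stated
  -- for any `M`, so that it also serves the transpose of the cycle matrix.
  cycle-row : ∀ {M : Matrix N} →
    (∀ i j → (Consec i j → M (to i) (to j) ≡ + 1) × (¬ Consec i j → M (to i) (to j) ≡ + 0)) →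
    ∀ x v → M (e (ℕ.suc x)) v ≡ idM (e x) v ℤ.+ idM (e (ℕ.suc (ℕ.suc x))) v
  cycle-row {M} spec x v with e-surjective 0 v
  ... | y , refl with e x Fin.≟ e y | e (ℕ.suc (ℕ.suc x)) Fin.≟ e y
  ...   | yes p | yes q = contradiction (trans p (sym q)) (e-2-apart x)
  ...   | yes p | no  _ = proj₁ (spec _ (y mod N))
    (inj₂ (subst (λ i → Next i (ℕ.suc x mod N)) (e-injective x y p) (next-mod x)))
  ...   | no  _ | yes q = proj₁ (spec _ (y mod N))
    (inj₁ (subst (Next (ℕ.suc x mod N)) (e-injective (ℕ.suc (ℕ.suc x)) y q) (next-mod (ℕ.suc x))))
  ...   | no  p | no  q = proj₂ (spec _ (y mod N)) λ c →
    [ p ∘ cong to , q ∘ cong to ]′ (consec-mod x c)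

-- The discrete wave equation.

sumFin-pick-two : ∀ {n} (f : Fin n → ℤ) a b →
  sumFin n (λ w → (idM a w ℤ.+ idM b w) ℤ.* f w) ≡ f a ℤ.+ f b
sumFin-pick-two {n} f a b = trans
  (sumFin-cong λ w → ℤₚ.*-distribʳ-+ (f w) (idM a w) (idM b w))
  (trans (sumFin-+ n (λ w → idM a w ℤ.* f w) (λ w → idM b w ℤ.* f w))
    (cong₂ ℤ._+_ (sumFin-idMˡ a f) (sumFin-idMˡ b f)))

-- The commutation of A with B is a discrete wave equation for α i j = A (e i) (e j).
module Wave (α : ℕ → ℕ → ℤ)
  (wave : ∀ i j → α (ℕ.suc (ℕ.suc i)) (ℕ.suc j) ℤ.+ α i (ℕ.suc j)
                ≡ α (ℕ.suc i) (ℕ.suc (ℕ.suc j)) ℤ.+ α (ℕ.suc i) j)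
  where

  -- The wave equation with step c; the indices are given up to equality so that no sum has to
  -- be rearranged inside α.
  wave-step : ∀ c i j {a a′ b b′} → a ≡ c ℕ.+ i → a′ ≡ c ℕ.+ a → b ≡ c ℕ.+ j → b′ ≡ c ℕ.+ b →
    α a′ b ℤ.+ α i b ≡ α a b′ ℤ.+ α a j
  wave-step 0 i j refl refl refl refl = refl
  wave-step 1 i j refl refl refl refl = wave i j
  -- Around the centre `(a, b)`: add step `c + 1` centred at `(a + 1, b)` and at `(a - 1, b)`,
  -- subtract step `c` centred at `(a, b)`, and regroup by `wave` at the centres `(a, b + c + 1)`
  -- and `(a, b - c - 1)`.
  wave-step (ℕ.suc (ℕ.suc c)) i j refl refl refl refl = combine
    (α a′ b) (α i b) (α a (2 ℕ.+ (c ℕ.+ b))) (α a j) (α (2 ℕ.+ i) b) (α (c ℕ.+ a) b)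
    (α a (c ℕ.+ b)) (α a (2 ℕ.+ j)) (α (1 ℕ.+ a) (1 ℕ.+ (c ℕ.+ b))) (α (1 ℕ.+ a) (1 ℕ.+ j))
    (α (1 ℕ.+ (c ℕ.+ i)) (1 ℕ.+ (c ℕ.+ b))) (α (1 ℕ.+ (c ℕ.+ i)) (1 ℕ.+ j))
    (wave-step (ℕ.suc c) (2 ℕ.+ i) (1 ℕ.+ j) {3 ℕ.+ (c ℕ.+ i)} {a′} {b} {1 ℕ.+ (c ℕ.+ b)}
      (s₁ c i) (s₂ c i) (s₃ c j) refl)
    (wave-step (ℕ.suc c) i (1 ℕ.+ j) {1 ℕ.+ (c ℕ.+ i)} {c ℕ.+ a} {b} {1 ℕ.+ (c ℕ.+ b)}
      refl (s₄ c i) (s₃ c j) refl)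
    (wave-step c (2 ℕ.+ i) (2 ℕ.+ j) {a} {c ℕ.+ a} {b} {c ℕ.+ b} (s₅ c i) refl (s₅ c j) refl)
    (wave (1 ℕ.+ (c ℕ.+ i)) (c ℕ.+ b))
    (wave (1 ℕ.+ (c ℕ.+ i)) j)
    where
    a a′ b : ℕ
    a  = 2 ℕ.+ (c ℕ.+ i)
    a′ = 2 ℕ.+ (c ℕ.+ a)
    b  = 2 ℕ.+ (c ℕ.+ j)

    s₁ : ∀ c i → 3 ℕ.+ (c ℕ.+ i) ≡ (1 ℕ.+ c) ℕ.+ (2 ℕ.+ i)
    s₁ = ℕ-solver.solve-∀
    s₂ : ∀ c i → 2 ℕ.+ (c ℕ.+ (2 ℕ.+ (c ℕ.+ i))) ≡ (1 ℕ.+ c) ℕ.+ (3 ℕ.+ (c ℕ.+ i))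
    s₂ = ℕ-solver.solve-∀
    s₃ : ∀ c j → 2 ℕ.+ (c ℕ.+ j) ≡ (1 ℕ.+ c) ℕ.+ (1 ℕ.+ j)
    s₃ = ℕ-solver.solve-∀
    s₄ : ∀ c i → c ℕ.+ (2 ℕ.+ (c ℕ.+ i)) ≡ (1 ℕ.+ c) ℕ.+ (1 ℕ.+ (c ℕ.+ i))
    s₄ = ℕ-solver.solve-∀
    s₅ : ∀ c i → 2 ℕ.+ (c ℕ.+ i) ≡ c ℕ.+ (2 ℕ.+ i)
    s₅ = ℕ-solver.solve-∀

    combine : ∀ p q r s x y g h a₁ a₂ a₃ a₄ →
      p ℤ.+ x ≡ a₁ ℤ.+ a₂ → y ℤ.+ q ≡ a₃ ℤ.+ a₄ → y ℤ.+ x ≡ g ℤ.+ h →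
      a₁ ℤ.+ a₃ ≡ r ℤ.+ g → a₂ ℤ.+ a₄ ≡ h ℤ.+ s → p ℤ.+ q ≡ r ℤ.+ s
    combine p q r s x y g h a₁ a₂ a₃ a₄ e₁ e₂ e₃ e₄ e₅ = begin
      p ℤ.+ q                                           ≡⟨ t₁ p q x y ⟩
      ((p ℤ.+ x) ℤ.+ (y ℤ.+ q)) ℤ.- (y ℤ.+ x)           ≡⟨ cong₂ ℤ._-_ (cong₂ ℤ._+_ e₁ e₂) e₃ ⟩
      ((a₁ ℤ.+ a₂) ℤ.+ (a₃ ℤ.+ a₄)) ℤ.- (g ℤ.+ h)       ≡⟨ cong (ℤ._- (g ℤ.+ h)) (t₂ a₁ a₂ a₃ a₄) ⟩
      ((a₁ ℤ.+ a₃) ℤ.+ (a₂ ℤ.+ a₄)) ℤ.- (g ℤ.+ h)       ≡⟨ cong (ℤ._- (g ℤ.+ h)) (cong₂ ℤ._+_ e₄ e₅) ⟩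
      ((r ℤ.+ g) ℤ.+ (h ℤ.+ s)) ℤ.- (g ℤ.+ h)           ≡⟨ t₃ r g h s ⟩
      r ℤ.+ s                                           ∎
      where
      open ≡-Reasoning
      t₁ : ∀ p q x y → p ℤ.+ q ≡ ((p ℤ.+ x) ℤ.+ (y ℤ.+ q)) ℤ.- (y ℤ.+ x)
      t₁ = solve-∀
      t₂ : ∀ a b c d → (a ℤ.+ b) ℤ.+ (c ℤ.+ d) ≡ (a ℤ.+ c) ℤ.+ (b ℤ.+ d)
      t₂ = solve-∀
      t₃ : ∀ r g h s → ((r ℤ.+ g) ℤ.+ (h ℤ.+ s)) ℤ.- (g ℤ.+ h) ≡ r ℤ.+ s
      t₃ = solve-∀

  module _ (α-diagonal : ∀ x → α x x ≡ + 0) where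

    -- Induction on `r`, starting from the zero diagonal. In the wave equation, two terms lie on the
    -- diagonal at distance `r * 2` and cancel; the other two lie on the next even diagonal.
    even-diagonal-suc : ∀ r x → α (ℕ.suc x) (r * 2 ℕ.+ ℕ.suc x) ≡ α x (r * 2 ℕ.+ x)
    even-diagonal-suc ℕ.zero    x = trans (α-diagonal (ℕ.suc x)) (sym (α-diagonal x))
    even-diagonal-suc (ℕ.suc r) x = +-cancelʳ (α (1 ℕ.+ x) (1 ℕ.+ z)) _ _ (begin
      α (1 ℕ.+ x) (2 ℕ.+ (r * 2 ℕ.+ ℕ.suc x)) ℤ.+ α (1 ℕ.+ x) (1 ℕ.+ z)
        ≡⟨ cong (λ y → α (1 ℕ.+ x) (2 ℕ.+ y) ℤ.+ α (1 ℕ.+ x) (1 ℕ.+ z)) (ℕ.+-suc (r * 2) x) ⟩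
      α (1 ℕ.+ x) (3 ℕ.+ z) ℤ.+ α (1 ℕ.+ x) (1 ℕ.+ z)
        ≡⟨ wave x (1 ℕ.+ z) ⟨
      α (2 ℕ.+ x) (2 ℕ.+ z) ℤ.+ α x (2 ℕ.+ z)
        ≡⟨ ℤₚ.+-comm (α (2 ℕ.+ x) (2 ℕ.+ z)) _ ⟩
      α x (2 ℕ.+ z) ℤ.+ α (2 ℕ.+ x) (2 ℕ.+ z)
        ≡⟨ cong (ℤ._+_ (α x (2 ℕ.+ z))) previous ⟩
      α x (2 ℕ.+ z) ℤ.+ α (1 ℕ.+ x) (1 ℕ.+ z) ∎)
      where
      open ≡-Reasoning
      z : ℕ
      z = r * 2 ℕ.+ x
      previous : α (2 ℕ.+ x) (2 ℕ.+ z) ≡ α (1 ℕ.+ x) (1 ℕ.+ z)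
      previous = begin
        α (2 ℕ.+ x) (2 ℕ.+ z)            ≡⟨ cong (α (2 ℕ.+ x)) (rearrange (r * 2) x) ⟩
        α (2 ℕ.+ x) (r * 2 ℕ.+ (2 ℕ.+ x)) ≡⟨ even-diagonal-suc r (1 ℕ.+ x) ⟩
        α (1 ℕ.+ x) (r * 2 ℕ.+ (1 ℕ.+ x)) ≡⟨ cong (α (1 ℕ.+ x)) (ℕ.+-suc (r * 2) x) ⟩
        α (1 ℕ.+ x) (1 ℕ.+ z)            ∎
        where
        rearrange : ∀ c x → 2 ℕ.+ (c ℕ.+ x) ≡ c ℕ.+ (2 ℕ.+ x)
        rearrange = ℕ-solver.solve-∀

    even-diagonal : ∀ r x y → α x (r * 2 ℕ.+ x) ≡ α y (r * 2 ℕ.+ y)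
    even-diagonal r x y = trans (from-0 x) (sym (from-0 y))
      where
      from-0 : ∀ x → α x (r * 2 ℕ.+ x) ≡ α 0 (r * 2 ℕ.+ 0)
      from-0 ℕ.zero    = refl
      from-0 (ℕ.suc x) = trans (even-diagonal-suc r x) (from-0 x)

-- Parity and the alternating sign.

parity : ∀ x → ∃ λ q → x ≡ q * 2 ⊎ x ≡ ℕ.suc (q * 2)
parity ℕ.zero = 0 , inj₁ refl
parity (ℕ.suc x) with parity x
... | q , inj₁ eq = q , inj₂ (cong ℕ.suc eq)
... | q , inj₂ eq = ℕ.suc q , inj₁ (cong ℕ.suc eq)

sgn : ℕ → ℤ
sgn ℕ.zero    = + 1
sgn (ℕ.suc x) = - sgn x

sgn-even+ : ∀ q x → sgn (q * 2 ℕ.+ x) ≡ sgn x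
sgn-even+ ℕ.zero    x = refl
sgn-even+ (ℕ.suc q) x = trans (ℤₚ.neg-involutive _) (sgn-even+ q x)

neg-one-squared : ∀ {s} → s ≡ + 1 ⊎ s ≡ - (+ 1) → s ℤ.* s ≡ + 1
neg-one-squared (inj₁ refl) = refl
neg-one-squared (inj₂ refl) = refl

-- Regular graphs whose polynomial value is J plus or minus a cycle matrix.

-- The sign `s` treats defect (1) and excess (-1) together. The index `suc m` is positive, so that
-- `(- d) ^ suc m` has the factor `d`.
module CyclicGraph {k : ℕ} (G : Graph (3 ℕ.+ k)) (d : ℕ) (regular : Regular G (ℕ.suc d))
  (B : Matrix (3 ℕ.+ k)) (σ : Fin (3 ℕ.+ k) ↔ Fin (3 ℕ.+ k))
  (B-spec : ∀ i j →
    (Consec i j → B (Inverse.to σ i) (Inverse.to σ j) ≡ + 1) ×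
    (¬ Consec i j → B (Inverse.to σ i) (Inverse.to σ j) ≡ + 0))
  (m : ℕ) (s : ℤ) (s≡±1 : s ≡ + 1 ⊎ s ≡ - (+ 1))
  (H≡J+sB : ∀ u v → evalM (Gpoly (ℕ.suc d) (ℕ.suc m)) (adjMatrix G) u v ≡ J u v ℤ.+ s ℤ.* B u v)
  where

  open RegularGraph G d regular
  open CyclicLabelling σ

  B-row : ∀ x v → B (e (ℕ.suc x)) v ≡ idM (e x) v ℤ.+ idM (e (ℕ.suc (ℕ.suc x))) v
  B-row = cycle-row {B} B-spec

  B-column : ∀ x v → B v (e (ℕ.suc x)) ≡ idM (e x) v ℤ.+ idM (e (ℕ.suc (ℕ.suc x))) v
  B-column = cycle-row {λ i j → B j i} λ i j →
    proj₁ (B-spec j i) ∘ swap , λ ¬c → proj₂ (B-spec j i) (¬c ∘ swap)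

  B-nonneg : ∀ u v → + 0 ℤ.≤ B u v
  B-nonneg u v with e-surjective 1 u
  ... | x , refl = ℤₚ.≤-trans (ℤₚ.+-mono-≤ (idM-nonneg (e x) v) (idM-nonneg (e (ℕ.suc (ℕ.suc x))) v))
    (ℤₚ.≤-reflexive (sym (B-row x v)))

  B-rowSum : ∀ u → sumFin N (B u) ≡ + 2
  B-rowSum u with e-surjective 1 u
  ... | x , refl = trans (sumFin-cong (B-row x)) (trans
    (sumFin-+ N (idM (e x)) (idM (e (ℕ.suc (ℕ.suc x)))))
    (cong₂ ℤ._+_ (sumFin-idM (e x)) (sumFin-idM (e (ℕ.suc (ℕ.suc x))))))

  -- `A` commutes with a polynomial in `A`, and with `J` because its row and column sums agree; what
  -- remains is `s` times the claim, and `s * s = 1`.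
  AB≡BA : ∀ u v → (A ⊗ B) u v ≡ (B ⊗ A) u v
  AB≡BA u v = s-cancel ((A ⊗ B) u v) ((B ⊗ A) u v) (+-cancelˡ (+ ℕ.suc d) _ _ (begin
    + ℕ.suc d ℤ.+ s ℤ.* (A ⊗ B) u v
      ≡⟨ cong₂ ℤ._+_ AJ (⊗-·Mʳ s A B u v) ⟨
    (A ⊗ J) u v ℤ.+ (A ⊗ (s ·M B)) u v
      ≡⟨ ⊗-distribˡ-⊕ A J (s ·M B) u v ⟨
    (A ⊗ (J ⊕ (s ·M B))) u v
      ≡⟨ ⊗-congʳ A H≡J+sB u v ⟨
    (A ⊗ H (ℕ.suc m)) u v
      ≡⟨ evalM-commutes (Gpoly (ℕ.suc d) (ℕ.suc m)) A u v ⟩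
    (H (ℕ.suc m) ⊗ A) u v
      ≡⟨ ⊗-congˡ A H≡J+sB u v ⟩
    ((J ⊕ (s ·M B)) ⊗ A) u v
      ≡⟨ ⊗-distribʳ-⊕ J (s ·M B) A u v ⟩
    (J ⊗ A) u v ℤ.+ ((s ·M B) ⊗ A) u v
      ≡⟨ cong₂ ℤ._+_ JA (⊗-·Mˡ s B A u v) ⟩
    + ℕ.suc d ℤ.+ s ℤ.* (B ⊗ A) u v ∎))
    where
    open ≡-Reasoning
    AJ : (A ⊗ J) u v ≡ + ℕ.suc d
    AJ = trans (sumFin-cong λ w → ℤₚ.*-identityʳ (A u w)) (A-row u)
    JA : (J ⊗ A) u v ≡ + ℕ.suc d
    JA = trans (sumFin-cong λ w → ℤₚ.*-identityˡ (A w v)) (A-column v)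
    s-cancel : ∀ x y → s ℤ.* x ≡ s ℤ.* y → x ≡ y
    s-cancel x y eq = begin
      x               ≡⟨ ℤₚ.*-identityˡ x ⟨
      + 1 ℤ.* x       ≡⟨ cong (ℤ._* x) (neg-one-squared s≡±1) ⟨
      s ℤ.* s ℤ.* x   ≡⟨ ℤₚ.*-assoc s s x ⟩
      s ℤ.* (s ℤ.* x) ≡⟨ cong (ℤ._*_ s) eq ⟩
      s ℤ.* (s ℤ.* y) ≡⟨ ℤₚ.*-assoc s s y ⟨
      s ℤ.* s ℤ.* y   ≡⟨ cong (ℤ._* y) (neg-one-squared s≡±1) ⟩
      + 1 ℤ.* y       ≡⟨ ℤₚ.*-identityˡ y ⟩
      y               ∎

  α : ℕ → ℕ → ℤ
  α i j = A (e i) (e j)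

  -- Compare the entries of BA and AB at positions `i + 1` and `j + 1`; each product by `B` picks
  -- out two neighbours on the cycle.
  α-wave : ∀ i j → α (ℕ.suc (ℕ.suc i)) (ℕ.suc j) ℤ.+ α i (ℕ.suc j)
                 ≡ α (ℕ.suc i) (ℕ.suc (ℕ.suc j)) ℤ.+ α (ℕ.suc i) j
  α-wave i j = begin
    α (ℕ.suc (ℕ.suc i)) (ℕ.suc j) ℤ.+ α i (ℕ.suc j)
      ≡⟨ ℤₚ.+-comm (α (ℕ.suc (ℕ.suc i)) (ℕ.suc j)) _ ⟩
    α i (ℕ.suc j) ℤ.+ α (ℕ.suc (ℕ.suc i)) (ℕ.suc j)
      ≡⟨ sumFin-pick-two (λ w → A w (e (ℕ.suc j))) (e i) (e (ℕ.suc (ℕ.suc i))) ⟨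
    sumFin N (λ w → (idM (e i) w ℤ.+ idM (e (ℕ.suc (ℕ.suc i))) w) ℤ.* A w (e (ℕ.suc j)))
      ≡⟨ sumFin-cong (λ w → cong (ℤ._* A w (e (ℕ.suc j))) (B-row i w)) ⟨
    (B ⊗ A) (e (ℕ.suc i)) (e (ℕ.suc j))
      ≡⟨ AB≡BA (e (ℕ.suc i)) (e (ℕ.suc j)) ⟨
    (A ⊗ B) (e (ℕ.suc i)) (e (ℕ.suc j))
      ≡⟨ sumFin-cong (λ w → trans (cong (ℤ._*_ (A (e (ℕ.suc i)) w)) (B-column j w))
           (ℤₚ.*-comm (A (e (ℕ.suc i)) w) _)) ⟩
    sumFin N (λ w → (idM (e j) w ℤ.+ idM (e (ℕ.suc (ℕ.suc j))) w) ℤ.* A (e (ℕ.suc i)) w)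
      ≡⟨ sumFin-pick-two (A (e (ℕ.suc i))) (e j) (e (ℕ.suc (ℕ.suc j))) ⟩
    α (ℕ.suc i) j ℤ.+ α (ℕ.suc i) (ℕ.suc (ℕ.suc j))
      ≡⟨ ℤₚ.+-comm (α (ℕ.suc i) j) _ ⟩
    α (ℕ.suc i) (ℕ.suc (ℕ.suc j)) ℤ.+ α (ℕ.suc i) j ∎
    where open ≡-Reasoning

  open Wave α α-wave

  α-even-diagonal : ∀ r x y → α x (r * 2 ℕ.+ x) ≡ α y (r * 2 ℕ.+ y)
  α-even-diagonal = even-diagonal (λ x → A-diagonal (e x))

  -- Each neighbour `v` of `s`, apart from `u` and one possible exception `y`, closes a 4-cycle u,
  -- s, v, t through the edge `u s`.
  ManySquares : Set
  ManySquares = ∃ λ u → ∃ λ s → ∃ λ y → Adjacent u s ×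
    (∀ v → Adjacent s v → ¬ u ≡ v → ¬ y ≡ v →
      ∃ λ t → ¬ s ≡ t × Adjacent u t × Adjacent t v)

  -- If all pairs at even distance c on the cycle are adjacent, then v ± c is adjacent to v, and by
  -- the wave equation with step c one of v ± c is adjacent to u whenever v is adjacent to u + c.
  even-edge⇒ManySquares : ∀ r x → α x (r * 2 ℕ.+ x) ≡ + 1 → ManySquares
  even-edge⇒ManySquares r x₀ edge =
    e a , e (c ℕ.+ a) , e (c ℕ.+ (c ℕ.+ a)) , step a , squares
    where
    c a : ℕ
    c = r * 2
    -- The vertex `u` sits at position `c`, not 0, so that the wave equation below, centred at `u`
    -- and `v`, can reach back to position 0.
    a = c ℕ.+ 0

    step : ∀ x → Adjacent (e x) (e (c ℕ.+ x))
    step x = A≡1⇒Adjacent _ _ (trans (α-even-diagonal r x x₀) edge)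

    squares : ∀ v → Adjacent (e (c ℕ.+ a)) v → ¬ e a ≡ v → ¬ e (c ℕ.+ (c ℕ.+ a)) ≡ v →
      ∃ λ t → ¬ e (c ℕ.+ a) ≡ t × Adjacent (e a) t × Adjacent t v
    squares v s~v u≢v y≢v with e-surjective c v
    -- The candidates for `t` are the positions `v + c` and `v - c`. The first equals `s` only if
    -- `v = u`, the second only if `v = y`.
    ... | j , refl with A-0or1 (e a) (e (c ℕ.+ (c ℕ.+ j))) | A-0or1 (e a) (e j)
    ...   | inj₂ one | _ = e (c ℕ.+ (c ℕ.+ j))
      , (λ eq → u≢v (e-unshift c {a} {c ℕ.+ j} eq))
      , A≡1⇒Adjacent _ _ one , Adjacent-sym (step (c ℕ.+ j))
    ...   | inj₁ _   | inj₂ one = e j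
      , (λ eq → y≢v (e-shift c {c ℕ.+ a} {j} eq))
      , A≡1⇒Adjacent _ _ one , step j
    -- If neither candidate is adjacent to `u`, the edge `s v` makes one side of the wave equation
    -- at least 1 while the other is 0.
    ...   | inj₁ zero₁ | inj₁ zero₂ = contradiction
      (ℤₚ.≤-trans (ℤₚ.+-mono-≤ (ℤₚ.≤-refl {+ 1}) (A-nonneg (e 0) (e (c ℕ.+ j))))
        (ℤₚ.≤-reflexive 1+x≡0))
      λ { (+≤+ ()) }
      where
      1+x≡0 : + 1 ℤ.+ α 0 (c ℕ.+ j) ≡ + 0
      1+x≡0 = begin
        + 1 ℤ.+ α 0 (c ℕ.+ j)
          ≡⟨ cong (ℤ._+ α 0 (c ℕ.+ j)) (A-adjacent s~v) ⟨
        α (c ℕ.+ a) (c ℕ.+ j) ℤ.+ α 0 (c ℕ.+ j)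
          ≡⟨ wave-step c 0 j {a} {c ℕ.+ a} {c ℕ.+ j} {c ℕ.+ (c ℕ.+ j)} refl refl refl refl ⟩
        α a (c ℕ.+ (c ℕ.+ j)) ℤ.+ α a j
          ≡⟨ cong₂ ℤ._+_ zero₁ zero₂ ⟩
        + 0 ∎
        where open ≡-Reasoning

  -- The bipartite case and its alternating eigenvector.

  module NoEvenEdge (no-even-edge : ∀ r x → α x (r * 2 ℕ.+ x) ≡ + 0) where

    -- On a cycle of odd length every position is congruent to an even one, so `e 0` would have no
    -- neighbour.
    N-odd⇒⊥ : ∀ q → N ≡ ℕ.suc (q * 2) → ⊥
    N-odd⇒⊥ q N≡ = contradiction
      (trans (sym (A-row (e 0))) (trans (sumFin-cong isolated) (sumFin-0 N))) λ ()
      where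
      isolated : ∀ v → A (e 0) v ≡ + 0
      isolated v with e-surjective 0 v
      ... | y , refl with parity y
      ...   | p , inj₁ refl = trans (cong (α 0) (sym (ℕ.+-identityʳ (p * 2)))) (no-even-edge p 0)
      -- An odd position becomes even after adding `N` once.
      ...   | p , inj₂ refl = trans (cong (A (e 0)) (sym e-y≡)) (no-even-edge (ℕ.suc (q ℕ.+ p)) 0)
        where
        rearrange : ∀ q p →
          ℕ.suc (q ℕ.+ p) ℕ.* 2 ℕ.+ 0 ≡ ℕ.suc (p ℕ.* 2) ℕ.+ 1 ℕ.* ℕ.suc (q ℕ.* 2)
        rearrange = ℕ-solver.solve-∀
        e-y≡ : e (ℕ.suc (q ℕ.+ p) * 2 ℕ.+ 0) ≡ e (ℕ.suc (p * 2))
        e-y≡ = cong (Inverse.to σ) (%≡⇒mod≡ (ℕ.suc (q ℕ.+ p) * 2 ℕ.+ 0) (ℕ.suc (p * 2)) (trans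
          (cong (_% N) (trans (rearrange q p) (cong (λ n → ℕ.suc (p * 2) ℕ.+ 1 ℕ.* n) (sym N≡))))
          ([m+kn]%n≡m%n (ℕ.suc (p * 2)) 1 N)))

    module _ (q : ℕ) (N≡ : N ≡ q * 2) where

      ε : Fin N → ℤ
      ε v = sgn (Fin.toℕ (Inverse.from σ v))

      -- Reduction modulo `N` removes a multiple of `q * 2`, which leaves the sign unchanged.
      ε-e : ∀ x → ε (e x) ≡ sgn x
      ε-e x = begin
        sgn (Fin.toℕ (Inverse.from σ (e x)))
          ≡⟨ cong (sgn ∘ Fin.toℕ) (Inverse.strictlyInverseʳ σ (x mod N)) ⟩
        sgn (Fin.toℕ (x mod N))
          ≡⟨ cong sgn (Fin.toℕ-fromℕ< (m%n<n x N)) ⟩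
        sgn (x % N)
          ≡⟨ sgn-even+ (x / N * q) (x % N) ⟨
        sgn (x / N * q * 2 ℕ.+ x % N)
          ≡⟨ cong sgn (trans (ℕ.+-comm _ (x % N)) (cong (ℕ._+_ (x % N)) (trans
               (ℕ.*-assoc (x / N) q 2) (cong (_*_ (x / N)) (sym N≡))))) ⟩
        sgn (x % N ℕ.+ x / N * N)
          ≡⟨ cong sgn (m≡m%n+[m/n]*n x N) ⟨
        sgn x ∎
        where open ≡-Reasoning

      -- Either the positions differ by an even number and the entry of `A` is 0, or the signs are
      -- opposite.
      ε-alternates : ∀ u v → A u v ℤ.* ε v ≡ A u v ℤ.* (- ε u)
      ε-alternates u v with e-surjective 0 u
      ... | x , refl with e-surjective x v
      ...   | y , refl with parity y
      ...     | p , inj₁ refl = trans (vanish (ε (e (x ℕ.+ p * 2)))) (sym (vanish (- ε (e x))))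
        where
        vanish : ∀ z → α x (x ℕ.+ p * 2) ℤ.* z ≡ + 0
        vanish z = cong (ℤ._* z)
          (trans (cong (α x) (ℕ.+-comm x (p * 2))) (no-even-edge p x))
      ...     | p , inj₂ refl = cong (ℤ._*_ (α x (x ℕ.+ ℕ.suc (p * 2)))) (begin
        ε (e (x ℕ.+ ℕ.suc (p * 2)))  ≡⟨ ε-e (x ℕ.+ ℕ.suc (p * 2)) ⟩
        sgn (x ℕ.+ ℕ.suc (p * 2))    ≡⟨ cong sgn (ℕ.+-comm x _) ⟩
        - sgn (p * 2 ℕ.+ x)          ≡⟨ cong -_ (sgn-even+ p x) ⟩
        - sgn x                      ≡⟨ cong -_ (ε-e x) ⟨
        - ε (e x)                    ∎)
        where open ≡-Reasoning

      -- The vector `ε` repeated in every column, so that the matrix lemmas apply to it.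
      E : Matrix N
      E u _ = ε u

      AE : ∀ u v → (A ⊗ E) u v ≡ - (+ ℕ.suc d) ℤ.* E u v
      AE u v = begin
        (A ⊗ E) u v                     ≡⟨ sumFin-cong (ε-alternates u) ⟩
        sumFin N (λ w → A u w ℤ.* (- ε u)) ≡⟨ sumFin-*ʳ N (A u) (- ε u) ⟩
        sumFin N (A u) ℤ.* (- ε u)      ≡⟨ cong (ℤ._* (- ε u)) (A-row u) ⟩
        + ℕ.suc d ℤ.* (- ε u)           ≡⟨ move (+ ℕ.suc d) (ε u) ⟩
        - (+ ℕ.suc d) ℤ.* ε u           ∎
        where
        open ≡-Reasoning
        move : ∀ x y → x ℤ.* (- y) ≡ (- x) ℤ.* y
        move = solve-∀

      -- G_{d,m}(−d) = (1 − d)^m, here with d + 1 in place of d.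
      HE : ∀ m u v → (H m ⊗ E) u v ≡ (- (+ d)) ℤ.^ m ℤ.* E u v
      HE 0 u v = trans (⊗-congˡ E (GM-0 (ℕ.suc d) A) u v)
        (trans (sumFin-idMˡ u ε) (sym (ℤₚ.*-identityˡ (ε u))))
      HE 1 u v = begin
        (H 1 ⊗ E) u v                               ≡⟨ ⊗-congˡ E (GM-1 (ℕ.suc d) A) u v ⟩
        ((idM ⊕ A) ⊗ E) u v                         ≡⟨ ⊗-distribʳ-⊕ idM A E u v ⟩
        (idM ⊗ E) u v ℤ.+ (A ⊗ E) u v               ≡⟨ cong₂ ℤ._+_ (sumFin-idMˡ u ε) (AE u v) ⟩
        ε u ℤ.+ - (+ 1 ℤ.+ + d) ℤ.* ε u             ≡⟨ collect (ε u) (+ d) ⟩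
        (- (+ d)) ℤ.^ 1 ℤ.* ε u                     ∎
        where
        open ≡-Reasoning
        collect : ∀ x d → x ℤ.+ - (+ 1 ℤ.+ d) ℤ.* x ≡ (- d) ℤ.* + 1 ℤ.* x
        collect = solve-∀
      HE (ℕ.suc (ℕ.suc m)) u v = begin
        (H (2 ℕ.+ m) ⊗ E) u v
          ≡⟨ ⊗-congˡ E (λ i j → trans (GM-suc-suc d m A i j)
               (cong (ℤ._+_ ((A ⊗ H (1 ℕ.+ m)) i j)) (ℤₚ.neg-distribˡ-* (+ d) (H m i j)))) u v ⟩
        (((A ⊗ H (1 ℕ.+ m)) ⊕ ((- (+ d)) ·M H m)) ⊗ E) u v
          ≡⟨ ⊗-distribʳ-⊕ (A ⊗ H (1 ℕ.+ m)) ((- (+ d)) ·M H m) E u v ⟩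
        ((A ⊗ H (1 ℕ.+ m)) ⊗ E) u v ℤ.+ (((- (+ d)) ·M H m) ⊗ E) u v
          ≡⟨ cong₂ ℤ._+_ (⊗-assoc A (H (1 ℕ.+ m)) E u v) (⊗-·Mˡ (- (+ d)) (H m) E u v) ⟩
        (A ⊗ (H (1 ℕ.+ m) ⊗ E)) u v ℤ.+ (- (+ d)) ℤ.* (H m ⊗ E) u v
          ≡⟨ cong₂ (λ x y → x ℤ.+ (- (+ d)) ℤ.* y)
               (trans (⊗-congʳ A (HE (ℕ.suc m)) u v) (⊗-·Mʳ (p ℤ.* p ℤ.^ m) A E u v))
               (HE m u v) ⟩
        p ℤ.* p ℤ.^ m ℤ.* (A ⊗ E) u v ℤ.+ (- (+ d)) ℤ.* (p ℤ.^ m ℤ.* ε u)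
          ≡⟨ cong (λ x → p ℤ.* p ℤ.^ m ℤ.* x ℤ.+ (- (+ d)) ℤ.* (p ℤ.^ m ℤ.* ε u)) (AE u v) ⟩
        p ℤ.* p ℤ.^ m ℤ.* (- (+ 1 ℤ.+ + d) ℤ.* ε u) ℤ.+ (- (+ d)) ℤ.* (p ℤ.^ m ℤ.* ε u)
          ≡⟨ collect (+ d) (p ℤ.^ m) (ε u) ⟩
        p ℤ.^ (2 ℕ.+ m) ℤ.* ε u ∎
        where
        open ≡-Reasoning
        p : ℤ
        p = - (+ d)
        collect : ∀ d q x →
          (- d) ℤ.* q ℤ.* (- (+ 1 ℤ.+ d) ℤ.* x) ℤ.+ (- d) ℤ.* (q ℤ.* x)
            ≡ (- d) ℤ.* ((- d) ℤ.* q) ℤ.* x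
        collect = solve-∀

      -- `P` is the eigenvalue of `H (suc m)` on `ε`; `c` is the sum of `ε`, which cancels in
      -- `P≡-2s`.
      P c : ℤ
      P = (- (+ d)) ℤ.^ ℕ.suc m
      c = (J ⊗ E) (e 0) (e 0)

      -- Apply `H (suc m)` to `ε` in two ways: through the eigenvalue and through `J + sB`.
      P*sgn : ∀ x → P ℤ.* sgn (ℕ.suc x) ≡ c ℤ.+ s ℤ.* (sgn x ℤ.+ sgn (ℕ.suc (ℕ.suc x)))
      P*sgn x = begin
        P ℤ.* sgn (ℕ.suc x)
          ≡⟨ cong (ℤ._*_ P) (ε-e (ℕ.suc x)) ⟨
        P ℤ.* ε u
          ≡⟨ HE (ℕ.suc m) u (e 0) ⟨
        (H (ℕ.suc m) ⊗ E) u (e 0)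
          ≡⟨ ⊗-congˡ E H≡J+sB u (e 0) ⟩
        ((J ⊕ (s ·M B)) ⊗ E) u (e 0)
          ≡⟨ ⊗-distribʳ-⊕ J (s ·M B) E u (e 0) ⟩
        c ℤ.+ ((s ·M B) ⊗ E) u (e 0)
          ≡⟨ cong (ℤ._+_ c) (⊗-·Mˡ s B E u (e 0)) ⟩
        c ℤ.+ s ℤ.* (B ⊗ E) u (e 0)
          ≡⟨ cong (λ y → c ℤ.+ s ℤ.* y) (trans
               (sumFin-cong λ w → cong (ℤ._* ε w) (B-row x w))
               (trans (sumFin-pick-two ε (e x) (e (ℕ.suc (ℕ.suc x))))
                 (cong₂ ℤ._+_ (ε-e x) (ε-e (ℕ.suc (ℕ.suc x)))))) ⟩
        c ℤ.+ s ℤ.* (sgn x ℤ.+ sgn (ℕ.suc (ℕ.suc x))) ∎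
        where
        open ≡-Reasoning
        u : Fin N
        u = e (ℕ.suc x)

      -- Positions 2 and 1 give P = c - 2s and -P = c + 2s; subtracting eliminates `c`.
      P≡-2s : P ≡ - (+ 2 ℤ.* s)
      P≡-2s = ℤₚ.*-cancelˡ-≡ (+ 2) P (- (+ 2 ℤ.* s)) (begin
        + 2 ℤ.* P                                               ≡⟨ t₁ P ⟩
        P ℤ.* + 1 ℤ.- P ℤ.* - (+ 1)                             ≡⟨ cong₂ ℤ._-_ (P*sgn 1) (P*sgn 0) ⟩
        (c ℤ.+ s ℤ.* (- (+ 2))) ℤ.- (c ℤ.+ s ℤ.* + 2)           ≡⟨ t₂ c s ⟩
        + 2 ℤ.* (- (+ 2 ℤ.* s))                                 ∎)
        where
        open ≡-Reasoning
        t₁ : ∀ p → + 2 ℤ.* p ≡ p ℤ.* + 1 ℤ.- p ℤ.* - (+ 1)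
        t₁ = solve-∀
        t₂ : ∀ c s → (c ℤ.+ s ℤ.* (- (+ 2))) ℤ.- (c ℤ.+ s ℤ.* + 2) ≡ + 2 ℤ.* (- (+ 2 ℤ.* s))
        t₂ = solve-∀

      d∣2 : d ∣ 2
      d∣2 = divides ℤ.∣ (- (+ d)) ℤ.^ m ∣ (begin
        2                                         ≡⟨ ∣-2s∣ s≡±1 ⟨
        ℤ.∣ - (+ 2 ℤ.* s) ∣                       ≡⟨ cong ℤ.∣_∣ P≡-2s ⟨
        ℤ.∣ (- (+ d)) ℤ.* (- (+ d)) ℤ.^ m ∣       ≡⟨ ℤₚ.abs-* (- (+ d)) _ ⟩
        ℤ.∣ - (+ d) ∣ * ℤ.∣ (- (+ d)) ℤ.^ m ∣     ≡⟨ cong (_* ℤ.∣ (- (+ d)) ℤ.^ m ∣) (ℤₚ.∣-i∣≡∣i∣ (+ d)) ⟩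
        d * ℤ.∣ (- (+ d)) ℤ.^ m ∣                 ≡⟨ ℕ.*-comm d _ ⟩
        ℤ.∣ (- (+ d)) ℤ.^ m ∣ * d                 ∎)
        where
        open ≡-Reasoning
        ∣-2s∣ : ∀ {s} → s ≡ + 1 ⊎ s ≡ - (+ 1) → ℤ.∣ - (+ 2 ℤ.* s) ∣ ≡ 2
        ∣-2s∣ (inj₁ refl) = refl
        ∣-2s∣ (inj₂ refl) = refl

    d≤2 : d ≤ 2
    d≤2 with parity N
    ... | q , inj₁ N≡ = ∣⇒≤ (d∣2 q N≡)
    ... | q , inj₂ N≡ = contradiction N≡ (N-odd⇒⊥ q)

  -- Doubly negated because no even edge is searched for: its absence is refuted by `d≤2`. This
  -- suffices, as both uses aim at a contradiction.
  ¬¬ManySquares : 3 ≤ d → ¬ ¬ ManySquares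
  ¬¬ManySquares 3≤d ¬sq = ℕ.<⇒≱ 3≤d (NoEvenEdge.d≤2 no-even-edge)
    where
    no-even-edge : ∀ r x → α x (r * 2 ℕ.+ x) ≡ + 0
    no-even-edge r x with A-0or1 (e x) (e (r * 2 ℕ.+ x))
    ... | inj₁ eq = eq
    ... | inj₂ eq = contradiction (even-edge⇒ManySquares r x eq) ¬sq

-- Nonexistence and the resulting bounds.

2≤1+i⇒1≤i : ∀ i → + 2 ℤ.≤ + 1 ℤ.+ i → + 1 ℤ.≤ i
2≤1+i⇒1≤i i 2≤1+i = subst (ℤ._≤_ (+ 1)) (cancel i) (ℤₚ.+-monoʳ-≤ (- (+ 1)) 2≤1+i)
  where
  cancel : ∀ i → - (+ 1) ℤ.+ (+ 1 ℤ.+ i) ≡ i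
  cancel = solve-∀

-- Every square through `u s` forces an entry at least 2 in row `u` of J + B, hence a nonzero entry
-- of `B`. The row sum 2 and the two excluded neighbours bound the degree by 4.
no-cyclic-defect : ∀ {n} d D (G : Graph n) → 5 ≤ d → ¬ CyclicDefect d D G
no-cyclic-defect (ℕ.suc d) (ℕ.suc (ℕ.suc D)) G (ℕ.s≤s 4≤d)
  (_ , regular , _ , _ , B , (ℕ.s≤s (ℕ.s≤s (ℕ.s≤s _)) , σ , B-spec) , H≡J+B) =
  ¬¬ManySquares (ℕ.≤-trans (ℕ.n≤1+n 3) 4≤d) λ (u , s , y , u~s , squares) →
    ℕ.<⇒≱ (ℕ.s≤s 4≤d) (ℤₚ.drop‿+≤+ (ℤₚ.≤-trans
      (degree-bound (B u) (B-nonneg u) s u y λ v s~v u≢v y≢v →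
        let t , s≢t , u~t , t~v = squares v s~v u≢v y≢v in
        2≤1+i⇒1≤i (B u v) (ℤₚ.≤-trans
          (two-paths⇒2≤H D u≢v s≢t u~s s~v u~t t~v) (ℤₚ.≤-reflexive (H≡J+B u v))))
      (ℤₚ.≤-reflexive (cong (ℤ._+ + 2) (B-rowSum u)))))
  where
  open RegularGraph G d regular using (degree-bound; two-paths⇒2≤H)
  open CyclicGraph G d regular B σ B-spec (ℕ.suc D) (+ 1) (inj₁ refl)
    (λ u v → trans (H≡J+B u v) (cong (ℤ._+_ (+ 1)) (sym (ℤₚ.*-identityˡ (B u v)))))
no-cyclic-defect (ℕ.suc _) ℕ.zero          G _ (_ , _ , () , _)
no-cyclic-defect (ℕ.suc _) (ℕ.suc ℕ.zero) G _ (_ , _ , ℕ.s≤s () , _)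

-- Neighbours in the cycle differ by irreflexivity, opposite vertices by hypothesis.
four-cycle : ∀ {n} (G : Graph n) {u s v t} → ¬ u ≡ v → ¬ s ≡ t →
  adj G u s ≡ true → adj G s v ≡ true → adj G u t ≡ true → adj G t v ≡ true → Cycle G 4
four-cycle {n} G {u} {s} {v} {t} u≢v s≢t u~s s~v u~t t~v =
  ℕ.n≤1+n 3 , f , (λ {i} {j} → lookup-injective distinct i j) , edge
  where
  adjacent⇒≢ : ∀ {x y} → adj G x y ≡ true → ¬ x ≡ y
  adjacent⇒≢ {x} x~y refl = contradiction (trans (sym x~y) (irrefl G x)) λ ()

  vertices : Vec (Fin n) 4
  vertices = u ∷ s ∷ v ∷ t ∷ []

  distinct : Unique vertices
  distinct = (adjacent⇒≢ u~s ∷ u≢v ∷ adjacent⇒≢ u~t ∷ [])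
    ∷ (adjacent⇒≢ s~v ∷ s≢t ∷ [])
    ∷ ((adjacent⇒≢ t~v ∘ sym) ∷ [])
    ∷ [] ∷ []

  f : Fin 4 → Fin n
  f = lookup vertices

  edge : ∀ i j → Next i j → adj G (f i) (f j) ≡ true
  edge i j (inj₁ p) = forward i j p
    where
    forward : ∀ i j → Fin.toℕ j ≡ ℕ.suc (Fin.toℕ i) → adj G (f i) (f j) ≡ true
    forward zero                   (suc zero)             _ = u~s
    forward (suc zero)             (suc (suc zero))       _ = s~v
    forward (suc (suc zero))       (suc (suc (suc zero))) _ = trans (adj-sym G v t) t~v
    forward (suc (suc (suc zero))) j                      p =
      contradiction p (ℕ.<⇒≢ (Fin.toℕ<n j))
  edge (suc (suc (suc zero))) zero (inj₂ _) = trans (adj-sym G t u) u~t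

-- Girth at least 5 forbids every square, so `s` has no neighbours besides `u` and `y`, and the
-- degree is at most 2.
no-cyclic-excess : ∀ {n} d g (G : Graph n) → 5 ≤ d → ¬ CyclicExcess d g G
no-cyclic-excess (ℕ.suc d) g@(ℕ.suc (ℕ.suc (ℕ.suc g′))) G (ℕ.s≤s 4≤d)
  (_ , regular , _ , 5≤g , (_ , no-shorter-cycle) ,
    B , (ℕ.s≤s (ℕ.s≤s (ℕ.s≤s _)) , σ , B-spec) , H≡J-B) =
  ¬¬ManySquares (ℕ.≤-trans (ℕ.n≤1+n 3) 4≤d) λ (u , s , y , u~s , squares) →
    ℕ.<⇒≱ (ℕ.≤-trans (ℕ.n≤1+n 3) (ℕ.≤-trans 4≤d (ℕ.n≤1+n d)))
      (ℤₚ.drop‿+≤+ (ℤₚ.≤-trans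
        (degree-bound (λ _ → + 0) (λ _ → ℤₚ.≤-refl) s u y λ v s~v u≢v y≢v →
          let t , s≢t , u~t , t~v = squares v s~v u≢v y≢v in
          contradiction (four-cycle G u≢v s≢t u~s s~v u~t t~v) (no-shorter-cycle 4 5≤g))
        (ℤₚ.≤-reflexive (cong (ℤ._+ + 2) (sumFin-0 N)))))
  where
  open RegularGraph G d regular using (degree-bound)
  open CyclicLabelling σ using (N)
  -- Since the girth is `3 + g′`, its half rounded down is the successor of this index.
  open CyclicGraph G d regular B σ B-spec ⌊ ℕ.suc g′ /2⌋ (- (+ 1)) (inj₂ refl)
    (λ u v → trans (H≡J-B u v) (cong (ℤ._+_ (+ 1)) (sym (ℤₚ.-1*i≡-i (B u v)))))
no-cyclic-excess d 0 G _ (_ , _ , _ , () , _)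
no-cyclic-excess d 1 G _ (_ , _ , _ , ℕ.s≤s () , _)
no-cyclic-excess d 2 G _ (_ , _ , _ , ℕ.s≤s (ℕ.s≤s ()) , _)

covers-[] : ∀ d → 5 ≤ d → Covers d []
covers-[] d 5≤d n G (inj₁ (D , defect)) = contradiction defect (no-cyclic-defect d D G 5≤d)
covers-[] d 5≤d n G (inj₂ (g , excess)) = contradiction excess (no-cyclic-excess d g G 5≤d)

theorem11 :
    -- finiteness for every odd d ≥ 5
    (∀ d → d % 2 ≡ 1 → 5 ≤ d → ∃ λ (L : List (Σ ℕ Graph)) → Covers d L)
    ×
    -- asymptotic bound O(d^{3/2}), squared: (#classes)^2 ≤ C d^3 for d ≥ d₀
    (∃ λ C → ∃ λ d₀ → ∀ d → d % 2 ≡ 1 → d₀ ≤ d →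
      ∃ λ (L : List (Σ ℕ Graph)) → Covers d L × length L * length L ≤ C * (d * d * d))
theorem11 =
  (λ d _ 5≤d → [] , covers-[] d 5≤d) ,
  -- The covering list is empty, so the constant 0 works from degree 5 on.
  0 , 5 , λ d _ 5≤d → [] , covers-[] d 5≤d , ℕ.z≤n
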